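{- If $(G,Z)$ is a suspect, then $G$ is not the line graph of a bipartite multigraph.
   Context: Graphs are finite and simple. Stable set: pairwise non-adjacent; strong: meets every maximal clique. Claw-free: no induced $K_{1,3}$. A path is a sequence of distinct vertices $p_0\hbox{ - }\dots\hbox{ - }p_k$ with $p_i$ adjacent to $p_j$ iff $|i-j|=1$; length $k$. Hole of length $k\ge4$: induced $C_k$; antihole: induced complement of $C_k$. Prism: two vertex-disjoint triangles $\{a_1,a_2,a_3\},\{b_1,b_2,b_3\}$ and paths $P_i$ with ends $a_i,b_i$, for $i<j$ only edges between $V(P_i),V(P_j)$ being $a_ia_j,b_ib_j$; odd if all $P_i$ odd. Handcuff: two vertex-disjoint even holes $C_1,C_2$ and a disjoint odd-length path $p_1\hbox{ - }\dots\hbox{ - }p_r$, $p_1$ with exactly two neighbours in $V(C_1)$, adjacent, $p_r$ with exactly two in $V(C_2)$, adjacent, no other edges among the parts. Eye mask: two vertex-disjoint even holes $C_1,C_2$, edges $x_1y_1\in E(C_1),x_2y_2\in E(C_2)$ with $\{x_1,y_1\}$ complete to $\{x_2,y_2\}$, no other edges between $V(C_1),V(C_2)$. Innocent: no odd hole, no antihole of length $\ge6$, no odd prism, handcuff or eye mask. Simplicial vertex: neighbourhood is a clique. Clown: graph on $\{c_0,\dots,c_k\}$, $c_1\hbox{ - }\dots\hbox{ - }c_k\hbox{ - }c_1$ an even hole, $c_0$ (the hat $h(D)$) adjacent to exactly $c_1,c_2$ among $c_1,\dots,c_k$. A vertex $v$ is safe if simplicial and for every clown $D$ in the graph every path with ends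 $v,h(D)$ whose vertices other than $h(D)$ are disjoint from and anticomplete to $V(D)\setminus\{h(D)\}$ has odd length. Even pair: every path between the two vertices has even length; consistent: every two members form an even pair. A pair $(G,Z)$ is a suspect if $G$ is a claw-free innocent graph, $Z$ is a consistent set of safe vertices of $G$ such that no strong stable set of $G$ contains $Z$, and $|V(G)|$ is minimum among all graphs $G$ for which such a pair exists. A bipartite multigraph is a loopless multigraph (parallel edges allowed) whose vertex set can be partitioned into two stable sets. The line graph $L(H)$ of a multigraph $H$ has the edges of $H$ as vertices, two being adjacent iff they share an endpoint. -}

module Defs where

open import Data.Nat using (ℕ; zero; suc; _+_; _≤_)
open import Data.Bool using (Bool; true; false)
open import Data.Fin using (Fin; toℕ)
import Data.Fin
import Data.Product
open import Data.Fin.Subset using (Subset; _∈_; _∉_; _⊆_)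
open import Data.Product using (Σ; ∃; _×_; _,_)
open import Data.Sum using (_⊎_)
open import Data.Empty using (⊥)
open import Relation.Nullary using (¬_)
open import Relation.Binary.PropositionalEquality using (_≡_; _≢_)
open import Function.Bundles using (_⇔_)
open import Function.Definitions using (Injective)

Even : ℕ → Set
Even k = ∃ λ m → k ≡ m + m

Odd : ℕ → Set
Odd k = ∃ λ m → k ≡ suc (m + m)

record Graph : Set where
  field
    n       : ℕ
    adj     : Fin n → Fin n → Bool
    adj-sym : ∀ u v → adj u v ≡ adj v u
    adj-irr : ∀ v → adj v v ≡ false

V : Graph → Set
V G = Fin (Graph.n G)

Adj : (G : Graph) → V G → V G → Set
Adj G u v = Graph.adj G u v ≡ true

VSet : Graph → Set
VSet G = Subset (Graph.n G)

Claw : Graph → Set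
Claw G = Σ (V G) λ a → Σ (V G) λ b → Σ (V G) λ c → Σ (V G) λ d →
  Adj G a b × Adj G a c × Adj G a d ×
  b ≢ c × b ≢ d × c ≢ d ×
  ¬ Adj G b c × ¬ Adj G b d × ¬ Adj G c d

ClawFree : Graph → Set
ClawFree G = ¬ Claw G

PathAdj : ∀ {k} → Fin k → Fin k → Set
PathAdj i j = (suc (toℕ i) ≡ toℕ j) ⊎ (suc (toℕ j) ≡ toℕ i)

CycAdj : (k : ℕ) → Fin k → Fin k → Set
CycAdj k i j = PathAdj i j ⊎ ((toℕ i ≡ 0 × suc (toℕ j) ≡ k) ⊎ (toℕ j ≡ 0 × suc (toℕ i) ≡ k))

record Path (G : Graph) (k : ℕ) : Set where
  field
    vtx   : Fin (suc k) → V G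
    inj   : Injective _≡_ _≡_ vtx
    edges : ∀ i j → Adj G (vtx i) (vtx j) ⇔ PathAdj i j

  first : V G
  first = vtx Data.Fin.zero

  last : V G
  last = vtx (Data.Fin.fromℕ k)

PathBetween : (G : Graph) (k : ℕ) → V G → V G → Path G k → Set
PathBetween G k u v P =
  (Path.first P ≡ u × Path.last P ≡ v) ⊎ (Path.first P ≡ v × Path.last P ≡ u)

record Hole (G : Graph) (k : ℕ) : Set where
  field
    long  : 4 ≤ k
    vtx   : Fin k → V G
    inj   : Injective _≡_ _≡_ vtx
    edges : ∀ i j → Adj G (vtx i) (vtx j) ⇔ CycAdj k i j

record Antihole (G : Graph) (k : ℕ) : Set where
  field
    vtx   : Fin k → V G
    inj   : Injective _≡_ _≡_ vtx
    edges : ∀ i j → Adj G (vtx i) (vtx j) ⇔ (i ≢ j × ¬ CycAdj k i j)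

EvenHole : Graph → Set
EvenHole G = Σ ℕ λ k → Even k × Hole G k

OddHole : Graph → Set
OddHole G = Σ ℕ λ k → Odd k × Hole G k

LongAntihole : Graph → Set
LongAntihole G = Σ ℕ λ k → 6 ≤ k × Antihole G k

-- three paths P_i (i ∈ Fin 3) from a_i = first to b_i = last, of length ≥ 1,
-- pairwise vertex-disjoint, and for i ≠ j the only edges between V(P_i), V(P_j)
-- are a_i a_j and b_i b_j (so {a_i} and {b_i} are disjoint triangles)
record Prism (G : Graph) : Set where
  field
    len      : Fin 3 → ℕ
    paths    : (i : Fin 3) → Path G (len i)
    nontriv  : ∀ i → 1 ≤ len i
    disjoint : ∀ i j → i ≢ j → ∀ s t →
               Path.vtx (paths i) s ≢ Path.vtx (paths j) t
    between  : ∀ i j → i ≢ j → ∀ s t →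
               Adj G (Path.vtx (paths i) s) (Path.vtx (paths j) t) ⇔
               ((toℕ s ≡ 0 × toℕ t ≡ 0) ⊎ (toℕ s ≡ len i × toℕ t ≡ len j))

OddPrism : Graph → Set
OddPrism G = Σ (Prism G) λ P → ∀ i → Odd (Prism.len P i)

TwoAdjNbrs : (G : Graph) {k : ℕ} → Hole G k → V G → Set
TwoAdjNbrs G {k} C x = Σ (Fin k) λ u → Σ (Fin k) λ v →
  u ≢ v × Adj G (Hole.vtx C u) (Hole.vtx C v) ×
  (∀ t → Adj G x (Hole.vtx C t) ⇔ (t ≡ u ⊎ t ≡ v))

record Handcuff (G : Graph) : Set where
  field
    k₁ k₂ r : ℕ
    C₁       : Hole G k₁
    C₂       : Hole G k₂
    even₁    : Even k₁
    even₂    : Even k₂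
    P        : Path G r
    oddP     : Odd r
    disj₁₂   : ∀ s t → Hole.vtx C₁ s ≢ Hole.vtx C₂ t
    disjP₁   : ∀ s t → Path.vtx P s ≢ Hole.vtx C₁ t
    disjP₂   : ∀ s t → Path.vtx P s ≢ Hole.vtx C₂ t
    anti₁₂   : ∀ s t → ¬ Adj G (Hole.vtx C₁ s) (Hole.vtx C₂ t)
    end₁     : TwoAdjNbrs G C₁ (Path.first P)
    end₂     : TwoAdjNbrs G C₂ (Path.last P)
    antiP₁   : ∀ s t → toℕ s ≢ 0 → ¬ Adj G (Path.vtx P s) (Hole.vtx C₁ t)
    antiP₂   : ∀ s t → toℕ s ≢ r → ¬ Adj G (Path.vtx P s) (Hole.vtx C₂ t)

record EyeMask (G : Graph) : Set where
  field
    k₁ k₂   : ℕ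
    C₁      : Hole G k₁
    C₂      : Hole G k₂
    even₁   : Even k₁
    even₂   : Even k₂
    disj    : ∀ s t → Hole.vtx C₁ s ≢ Hole.vtx C₂ t
    x₁ y₁   : Fin k₁
    x₂ y₂   : Fin k₂
    edge₁   : Adj G (Hole.vtx C₁ x₁) (Hole.vtx C₁ y₁)
    edge₂   : Adj G (Hole.vtx C₂ x₂) (Hole.vtx C₂ y₂)
    between : ∀ s t → Adj G (Hole.vtx C₁ s) (Hole.vtx C₂ t) ⇔
              ((s ≡ x₁ ⊎ s ≡ y₁) × (t ≡ x₂ ⊎ t ≡ y₂))

Innocent : Graph → Set
Innocent G = ¬ OddHole G × ¬ LongAntihole G × ¬ OddPrism G ×
             ¬ Handcuff G × ¬ EyeMask G

Stable : (G : Graph) → VSet G → Set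
Stable G S = ∀ u v → u ∈ S → v ∈ S → ¬ Adj G u v

Clique : (G : Graph) → VSet G → Set
Clique G K = (∃ λ v → v ∈ K) × (∀ u v → u ∈ K → v ∈ K → u ≢ v → Adj G u v)

MaximalClique : (G : Graph) → VSet G → Set
MaximalClique G K = Clique G K × (∀ K′ → Clique G K′ → K ⊆ K′ → K′ ⊆ K)

StrongStable : (G : Graph) → VSet G → Set
StrongStable G S = Stable G S ×
  (∀ K → MaximalClique G K → ∃ λ v → v ∈ S × v ∈ K)

Simplicial : (G : Graph) → V G → Set
Simplicial G v = ∀ u w → Adj G v u → Adj G v w → u ≢ w → Adj G u w

-- clown: hat c₀ and an even hole c_1 - ... - c_k - c_1 (here vtx 0, ..., vtx (k-1)),
-- c₀ adjacent to exactly c_1, c_2 among the hole vertices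
record Clown (G : Graph) : Set where
  field
    k       : ℕ
    hat     : V G
    C       : Hole G k
    evenC   : Even k
    hatOut  : ∀ t → hat ≢ Hole.vtx C t
    hatAdj  : ∀ t → Adj G hat (Hole.vtx C t) ⇔ (toℕ t ≡ 0 ⊎ toℕ t ≡ 1)

Safe : (G : Graph) → V G → Set
Safe G v = Simplicial G v ×
  (∀ (D : Clown G) (k : ℕ) (P : Path G k) →
     PathBetween G k v (Clown.hat D) P →
     (∀ s → Path.vtx P s ≢ Clown.hat D → ∀ t →
        Path.vtx P s ≢ Hole.vtx (Clown.C D) t ×
        ¬ Adj G (Path.vtx P s) (Hole.vtx (Clown.C D) t)) →
     Odd k)

EvenPair : (G : Graph) → V G → V G → Set
EvenPair G u v = ∀ (k : ℕ) (P : Path G k) → PathBetween G k u v P → Even k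

Consistent : (G : Graph) → VSet G → Set
Consistent G Z = ∀ u v → u ∈ Z → v ∈ Z → EvenPair G u v

Candidate : (G : Graph) → VSet G → Set
Candidate G Z = ClawFree G × Innocent G × Consistent G Z ×
  (∀ v → v ∈ Z → Safe G v) ×
  (¬ Σ (VSet G) λ S → StrongStable G S × Z ⊆ S)

Suspect : (G : Graph) → VSet G → Set
Suspect G Z = Candidate G Z ×
  (∀ (G′ : Graph) (Z′ : VSet G′) → Candidate G′ Z′ → Graph.n G ≤ Graph.n G′)

ShareEnd : ∀ {m} → Fin m × Fin m → Fin m × Fin m → Set
ShareEnd (a , b) (c , d) = (a ≡ c ⊎ a ≡ d) ⊎ (b ≡ c ⊎ b ≡ d)

-- G ≅ L(H) for a bipartite (loopless) multigraph H on vertex set Fin m whose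
-- edges are labelled by the vertices of G (the isomorphism is this labelling);
-- parallel edges are allowed since distinct labels may have the same ends
LineGraphOfBipartiteMultigraph : Graph → Set
LineGraphOfBipartiteMultigraph G =
  Σ ℕ λ m → Σ (V G → Fin m × Fin m) λ ends → Σ (Fin m → Bool) λ side →
    (∀ e → side (Data.Product.proj₁ (ends e)) ≢ side (Data.Product.proj₂ (ends e))) ×
    (∀ e f → e ≢ f → Adj G e f ⇔ ShareEnd (ends e) (ends f))

{- Let G = L(H) with H a bipartite multigraph.  Up to isolated edges, the maximal cliques of G
   are the sets of edges at the vertices of H with at least two neighbours, and an edge of Z,
   being simplicial, has an end with a single neighbour (a Z-leaf).  So a matching of H that
   covers all these vertices, and uses an edge of Z wherever a parallel one could be used, is
   a strong stable set containing Z.  Vertices are covered one at a time.  From an uncovered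
   vertex a, grow an alternating path; it ends in an augmentation (or in a mate that need not
   be covered) unless its last vertex, on the side of a, is a Z-leaf or only has neighbours on
   the path.  Growing from a in both directions gives a path w₀ … wₙ of H with both ends on the
   side of a, where w₀ is a Z-leaf or has a chord to some wᵢ, and wₙ is a Z-leaf or has a chord
   to some wⱼ.  Two chords give a handcuff if i < j, an eye mask if i = j and an odd prism if
   i > j; the parities are right because wᵢ and wⱼ are on the same side.  A Z-leaf and a chord
   give a clown contradicting safety, and two Z-leaves contradict consistency. -}

module Submission where

open import Defs
open import Data.Bool using (Bool; true; false; not; if_then_else_)
open import Data.Bool.Properties using (¬-not; not-¬; not-involutive)
open import Data.Empty using (⊥; ⊥-elim)
open import Data.Fin using (Fin; zero; suc; toℕ; fromℕ; fromℕ<)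
open import Data.Fin.Properties using (toℕ-injective; toℕ<n; toℕ-fromℕ; toℕ-fromℕ<; injective⇒≤; any?)
open import Data.Fin.Subset using (_∈_; _⊆_)
open import Data.Fin.Subset.Properties using (_∈?_)
open import Data.List using ([]; _∷_; allFin)
import Data.List.Membership.Propositional as List
open import Data.List.Membership.Propositional.Properties using (∈-allFin)
open import Data.List.Relation.Unary.Any using (here; there)
open import Data.Nat using (ℕ; zero; suc; _+_; _∸_; _≤_; _<_; z≤n; s≤s)
open import Data.Nat.Properties
open import Data.Product using (∃; _×_; _,_; proj₁; proj₂)
open import Data.Sum using (_⊎_; inj₁; inj₂)
open import Data.Vec using (tabulate)
open import Data.Vec.Properties using (lookup∘tabulate; lookup⇒[]=; []=⇒lookup)
open import Function using (_∘_)
open import Function.Bundles using (_⇔_; mk⇔; Equivalence)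
open import Relation.Nullary using (¬_; Dec; yes; no; does; _×-dec_; _⊎-dec_)
open import Relation.Nullary.Decidable using (¬¬-excluded-middle; decidable-stable; dec-true; dec-false; map′)
open import Relation.Binary.Definitions using (Tri; tri<; tri≈; tri>)
open import Relation.Binary.PropositionalEquality

-- Parity

even⇒¬odd : ∀ {k} → Even k → ¬ Odd k
even⇒¬odd (zero , refl) (_ , ())
even⇒¬odd (suc a , refl) (zero , eq) with trans (sym (+-suc a a)) (suc-injective eq)
... | ()
even⇒¬odd (suc a , refl) (suc b , eq) =
  even⇒¬odd (a , refl) (b , suc-injective (trans (sym (+-suc a a)) (trans (suc-injective eq) (cong suc (+-suc b b)))))

even⊎odd : ∀ k → Even k ⊎ Odd k
even⊎odd zero = inj₁ (0 , refl)
even⊎odd (suc k) with even⊎odd k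
... | inj₁ (a , refl) = inj₂ (a , refl)
... | inj₂ (a , refl) = inj₁ (suc a , cong suc (sym (+-suc a a)))

even-suc : ∀ {k} → Even (suc k) → Odd k
even-suc {k} e with even⊎odd k
... | inj₁ (a , refl) = ⊥-elim (even⇒¬odd e (a , refl))
... | inj₂ o = o

0<4 : 0 < 4
0<4 = s≤s z≤n

1<4 : 1 < 4
1<4 = s≤s (s≤s z≤n)

≢-≢⇒≡ : ∀ {a b c : Bool} → a ≢ b → b ≢ c → a ≡ c
≢-≢⇒≡ {_} {b} {c} a≢b b≢c =
  trans (¬-not a≢b) (trans (cong not (¬-not b≢c)) (not-involutive c))

-- The root multigraph: ends of edges, links and walks

module LineGraph
  (G : Graph) (Z : VSet G) (m : ℕ)
  (ends : V G → Fin m × Fin m) (side : Fin m → Bool)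
  (bipartite : ∀ e → side (proj₁ (ends e)) ≢ side (proj₂ (ends e)))
  (line : ∀ e f → e ≢ f → Adj G e f ⇔ ShareEnd (ends e) (ends f))
  where

  Joins : V G → Fin m → Fin m → Set
  Joins e u v = ends e ≡ (u , v) ⊎ ends e ≡ (v , u)

  joins-ends : ∀ e → Joins e (proj₁ (ends e)) (proj₂ (ends e))
  joins-ends e = inj₁ refl

  joins-sym : ∀ {e u v} → Joins e u v → Joins e v u
  joins-sym (inj₁ p) = inj₂ p
  joins-sym (inj₂ p) = inj₁ p

  joins-side : ∀ {e u v} → Joins e u v → side u ≢ side v
  joins-side {e} (inj₁ p) eq = bipartite e (trans (cong (side ∘ proj₁) p) (trans eq (sym (cong (side ∘ proj₂) p))))
  joins-side {e} (inj₂ p) eq = bipartite e (trans (cong (side ∘ proj₁) p) (trans (sym eq) (sym (cong (side ∘ proj₂) p))))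

  joins-irrefl : ∀ {e u v} → Joins e u v → u ≢ v
  joins-irrefl j refl = joins-side j refl

  joins-unique : ∀ {e f u v x y} → e ≡ f → Joins e u v → Joins f x y → (u ≡ x × v ≡ y) ⊎ (u ≡ y × v ≡ x)
  joins-unique refl (inj₁ p) (inj₁ q) with trans (sym p) q
  ... | refl = inj₁ (refl , refl)
  joins-unique refl (inj₁ p) (inj₂ q) with trans (sym p) q
  ... | refl = inj₂ (refl , refl)
  joins-unique refl (inj₂ p) (inj₁ q) with trans (sym p) q
  ... | refl = inj₂ (refl , refl)
  joins-unique refl (inj₂ p) (inj₂ q) with trans (sym p) q
  ... | refl = inj₁ (refl , refl)

  shareEnd-resp : ∀ {e f u v x y} → Joins e u v → Joins f x y →
    ShareEnd (ends e) (ends f) ⇔ ShareEnd (u , v) (x , y)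
  shareEnd-resp (inj₁ p) (inj₁ q) rewrite p | q = mk⇔ (λ s → s) (λ s → s)
  shareEnd-resp (inj₁ p) (inj₂ q) rewrite p | q = mk⇔ swapʳ swapʳ
    where
    swapʳ : ∀ {u v x y : Fin m} → ShareEnd (u , v) (x , y) → ShareEnd (u , v) (y , x)
    swapʳ (inj₁ (inj₁ r)) = inj₁ (inj₂ r)
    swapʳ (inj₁ (inj₂ r)) = inj₁ (inj₁ r)
    swapʳ (inj₂ (inj₁ r)) = inj₂ (inj₂ r)
    swapʳ (inj₂ (inj₂ r)) = inj₂ (inj₁ r)
  shareEnd-resp (inj₂ p) (inj₁ q) rewrite p | q = mk⇔ swapˡ swapˡ
    where
    swapˡ : ∀ {u v x y : Fin m} → ShareEnd (u , v) (x , y) → ShareEnd (v , u) (x , y)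
    swapˡ (inj₁ r) = inj₂ r
    swapˡ (inj₂ r) = inj₁ r
  shareEnd-resp (inj₂ p) (inj₂ q) rewrite p | q = mk⇔ swap² swap²
    where
    swap² : ∀ {u v x y : Fin m} → ShareEnd (u , v) (x , y) → ShareEnd (v , u) (y , x)
    swap² (inj₁ (inj₁ r)) = inj₂ (inj₂ r)
    swap² (inj₁ (inj₂ r)) = inj₂ (inj₁ r)
    swap² (inj₂ (inj₁ r)) = inj₁ (inj₂ r)
    swap² (inj₂ (inj₂ r)) = inj₁ (inj₁ r)

  adj⇒≢ : ∀ {e f} → Adj G e f → e ≢ f
  adj⇒≢ {e} a refl with trans (sym a) (Graph.adj-irr G e)
  ... | ()

  adj⇒share : ∀ {e f u v x y} → Joins e u v → Joins f x y → Adj G e f → ShareEnd (u , v) (x , y)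
  adj⇒share {e} {f} j k a =
    Equivalence.to (shareEnd-resp j k) (Equivalence.to (line e f (adj⇒≢ {e} {f} a)) a)

  share⇒adj : ∀ {e f u v x y} → Joins e u v → Joins f x y → e ≢ f → ShareEnd (u , v) (x , y) → Adj G e f
  share⇒adj {e} {f} j k e≢f s =
    Equivalence.from (line e f e≢f) (Equivalence.from (shareEnd-resp j k) s)

  -- An edge parallel to a member of Z is canonical only if it is that member.
  Canonical : V G → Set
  Canonical e = ∀ z → z ∈ Z → ∀ {u v} → Joins e u v → Joins z u v → z ≡ e

  -- The edge is part of the data because parallel edges are distinct vertices of `G`. Requiring it
  -- to be canonical ensures that a link at a Z-leaf is the member of `Z` itself, so that trails of
  -- `H` yield paths of `G` that really end in `Z`.
  record Link (u v : Fin m) : Set where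
    constructor link
    field
      edge      : V G
      joins     : Joins edge u v
      canonical : Canonical edge

  link-sym : ∀ {u v} → Link u v → Link v u
  link-sym (link e j c) = link e (joins-sym j) c

  link-side : ∀ {u v} → Link u v → side u ≢ side v
  link-side l = joins-side (Link.joins l)

  link-irrefl : ∀ {u v} → Link u v → u ≢ v
  link-irrefl l = joins-irrefl (Link.joins l)

  -- The vertex sequence is a total function of which only the values up to `k` count. Reversals,
  -- segments and shifts are then plain reindexings.
  Walk : ℕ → (ℕ → Fin m) → Set
  Walk k v = ∀ i → i < k → Link (v i) (v (suc i))

  -- Each link changes sides. The parities of trails, arcs and cycles are all read off the sides of
  -- their ends in this way.
  walk-parity : ∀ k v → Walk k v →
    (side (v 0) ≡ side (v k) × Even k) ⊎ (side (v 0) ≢ side (v k) × Odd k)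
  walk-parity zero v w = inj₁ (refl , 0 , refl)
  walk-parity (suc k) v w with walk-parity k v (λ i i<k → w i (m≤n⇒m≤1+n i<k)) | link-side (w k ≤-refl)
  ... | inj₁ (p , a , refl) | q = inj₂ ((λ r → q (trans (sym p) r)) , a , refl)
  ... | inj₂ (p , a , refl) | q = inj₁ (≢-≢⇒≡ p q , suc a , cong suc (sym (+-suc a a)))

  walk-even : ∀ {k v} → Walk k v → side (v 0) ≡ side (v k) → Even k
  walk-even {k} {v} w p with walk-parity k v w
  ... | inj₁ (_ , e) = e
  ... | inj₂ (q , _) = ⊥-elim (q p)

  walk-odd : ∀ {k v} → Walk k v → side (v 0) ≢ side (v k) → Odd k
  walk-odd {k} {v} w p with walk-parity k v w
  ... | inj₁ (q , _) = ⊥-elim (p q)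
  ... | inj₂ (_ , o) = o

  edgeAt : ∀ {k v} → Walk k v → Fin k → V G
  edgeAt w s = Link.edge (w (toℕ s) (toℕ<n s))

  joinsAt : ∀ {k v} (w : Walk k v) s → Joins (edgeAt w s) (v (toℕ s)) (v (suc (toℕ s)))
  joinsAt w s = Link.joins (w (toℕ s) (toℕ<n s))

  -- Trails and cycles of H as paths and holes of G

  record Trail (k : ℕ) (v : ℕ → Fin m) : Set where
    field
      walk     : Walk k v
      distinct : ∀ {i j} → i ≤ k → j ≤ k → v i ≡ v j → i ≡ j

  module _ {r v} (T : Trail (suc r) v) where
    open Trail T

    private
      lo : (s : Fin (suc r)) → toℕ s ≤ suc r
      lo s = <⇒≤ (toℕ<n s)

      hi : (s : Fin (suc r)) → suc (toℕ s) ≤ suc r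
      hi s = toℕ<n s

      consecutive⇒≢ : ∀ s t → suc (toℕ s) ≡ toℕ t → edgeAt walk s ≢ edgeAt walk t
      consecutive⇒≢ s t p eq with joins-unique eq (joinsAt walk s) (joinsAt walk t)
      ... | inj₁ (q , _) = 1+n≢n (trans p (sym (distinct (lo s) (lo t) q)))
      ... | inj₂ (q , _) = m≢1+n+m (toℕ s) {1} (trans (distinct (lo s) (hi t) q) (cong suc (sym p)))

    -- As the vertices of the trail are distinct, two of its edges share an end only if they are
    -- consecutive. The `suc r` edges become `suc r` vertices, so the path has length `r`: an even
    -- number of edges in `H` means an odd path in `G`.
    trailPath : Path G r
    trailPath = record
      { vtx = edgeAt walk
      ; inj = λ {s} {t} → inj′ s t
      ; edges = λ s t → mk⇔ (to s t) (from s t) }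
      where
      inj′ : ∀ s t → edgeAt walk s ≡ edgeAt walk t → s ≡ t
      inj′ s t eq with joins-unique eq (joinsAt walk s) (joinsAt walk t)
      ... | inj₁ (q , _) = toℕ-injective (distinct (lo s) (lo t) q)
      ... | inj₂ (q , q′) =
        ⊥-elim (m≢1+n+m (toℕ s) {1} (trans (distinct (lo s) (hi t) q) (cong suc (sym (distinct (hi s) (lo t) q′)))))

      same : ∀ {A : Set} s t → Adj G (edgeAt walk s) (edgeAt walk t) → toℕ s ≡ toℕ t → A
      same s t a p with toℕ-injective {i = s} {t} p
      ... | refl = ⊥-elim (adj⇒≢ {edgeAt walk s} {edgeAt walk s} a refl)

      to : ∀ s t → Adj G (edgeAt walk s) (edgeAt walk t) → PathAdj s t
      to s t a with adj⇒share (joinsAt walk s) (joinsAt walk t) a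
      ... | inj₁ (inj₁ p) = same s t a (distinct (lo s) (lo t) p)
      ... | inj₁ (inj₂ p) = inj₂ (sym (distinct (lo s) (hi t) p))
      ... | inj₂ (inj₁ p) = inj₁ (distinct (hi s) (lo t) p)
      ... | inj₂ (inj₂ p) = same s t a (suc-injective (distinct (hi s) (hi t) p))

      from : ∀ s t → PathAdj s t → Adj G (edgeAt walk s) (edgeAt walk t)
      from s t (inj₁ p) = share⇒adj (joinsAt walk s) (joinsAt walk t) (consecutive⇒≢ s t p) (inj₂ (inj₁ (cong v p)))
      from s t (inj₂ p) = share⇒adj (joinsAt walk s) (joinsAt walk t) (≢-sym (consecutive⇒≢ t s p)) (inj₁ (inj₂ (cong v (sym p))))

  -- c 1 serves as the base point: it lies on the edges 0 and 1, as the hat of a Clown requires.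
  record Cycle (k : ℕ) (c : ℕ → Fin m) : Set where
    field
      long     : 4 ≤ k
      closed   : c 0 ≡ c k
      walk     : Walk k c
      distinct : ∀ {i j} → i < k → j < k → c i ≡ c j → i ≡ j

    distinct-suc : ∀ {i j} → i < k → j < k → c i ≡ c (suc j) → i ≡ suc j ⊎ (i ≡ 0 × suc j ≡ k)
    distinct-suc {i} {j} i<k j<k p with m≤n⇒m<n∨m≡n j<k
    ... | inj₁ lt = inj₁ (distinct i<k lt p)
    ... | inj₂ refl = inj₂ (distinct i<k (≤-trans (s≤s z≤n) long) (trans p (sym closed)) , refl)

    even : Even k
    even = walk-even walk (cong side closed)

    private
      clash : ∀ {i} → suc (suc i) ≡ k → i ≡ 0 → ∀ {A : Set} → A
      clash refl refl with long
      ... | s≤s (s≤s ())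

      -- Two different positions with the same pair of ends, met in opposite orders, would force the
      -- cycle to have length 2.
      same-ends : ∀ {i j} → i < k → j < k →
        (c i ≡ c j × c (suc i) ≡ c (suc j)) ⊎ (c i ≡ c (suc j) × c (suc i) ≡ c j) → i ≡ j
      same-ends i<k j<k (inj₁ (p , _)) = distinct i<k j<k p
      same-ends {i} {j} i<k j<k (inj₂ (p , q)) with distinct-suc i<k j<k p | distinct-suc j<k i<k (sym q)
      ... | inj₁ a | inj₁ b = ⊥-elim (m≢1+n+m i {1} (trans a (cong suc b)))
      ... | inj₁ a | inj₂ (b , d) = clash (trans (sym (cong suc a)) d) b
      ... | inj₂ (a , d) | inj₁ b = clash (trans (sym (cong suc b)) d) a
      ... | inj₂ (a , d) | inj₂ (b , _) = trans a (sym b)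

    edgeAt-injective : ∀ s t → edgeAt walk s ≡ edgeAt walk t → s ≡ t
    edgeAt-injective s t eq = toℕ-injective (same-ends (toℕ<n s) (toℕ<n t)
      (joins-unique eq (joinsAt walk s) (joinsAt walk t)))

    hole : Hole G k
    hole = record
      { long = long
      ; vtx = edgeAt walk
      ; inj = λ {s} {t} → edgeAt-injective s t
      ; edges = λ s t → mk⇔ (to s t) (from s t) }
      where
      same : ∀ {A : Set} s t → Adj G (edgeAt walk s) (edgeAt walk t) → s ≡ t → A
      same s t a refl = ⊥-elim (adj⇒≢ {edgeAt walk s} {edgeAt walk s} a refl)

      to : ∀ s t → Adj G (edgeAt walk s) (edgeAt walk t) → CycAdj k s t
      to s t a with adj⇒share (joinsAt walk s) (joinsAt walk t) a
      to s t a | inj₁ (inj₁ p) = same s t a (toℕ-injective (distinct (toℕ<n s) (toℕ<n t) p))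
      to s t a | inj₁ (inj₂ p) with distinct-suc (toℕ<n s) (toℕ<n t) p
      ... | inj₁ q = inj₁ (inj₂ (sym q))
      ... | inj₂ q = inj₂ (inj₁ q)
      to s t a | inj₂ (inj₁ p) with distinct-suc (toℕ<n t) (toℕ<n s) (sym p)
      ... | inj₁ q = inj₁ (inj₁ (sym q))
      ... | inj₂ q = inj₂ (inj₂ q)
      to s t a | inj₂ (inj₂ p) with m≤n⇒m<n∨m≡n (toℕ<n s) | m≤n⇒m<n∨m≡n (toℕ<n t)
      ... | inj₁ x | inj₁ y = same s t a (toℕ-injective (suc-injective (distinct x y p)))
      ... | inj₂ x | inj₂ y = same s t a (toℕ-injective (suc-injective (trans x (sym y))))
      ... | inj₁ x | inj₂ y with distinct-suc x (toℕ<n t) p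
      ...   | inj₁ z = same s t a (toℕ-injective (suc-injective z))
      to s t a | inj₂ (inj₂ p) | inj₂ x | inj₁ y with distinct-suc y (toℕ<n s) (sym p)
      ...   | inj₁ z = same s t a (toℕ-injective (suc-injective (sym z)))

      noLoop : ∀ i j → suc i ≡ j ⊎ (i ≡ 0 × suc j ≡ k) → i ≢ j
      noLoop i j (inj₁ p) refl = 1+n≢n p
      noLoop .0 .0 (inj₂ (refl , p)) refl with subst (4 ≤_) (sym p) long
      ... | s≤s ()

      half : ∀ s t → suc (toℕ s) ≡ toℕ t ⊎ (toℕ s ≡ 0 × suc (toℕ t) ≡ k) → edgeAt walk s ≢ edgeAt walk t
      half s t p eq = noLoop (toℕ s) (toℕ t) p (cong toℕ (edgeAt-injective s t eq))

      from : ∀ s t → CycAdj k s t → Adj G (edgeAt walk s) (edgeAt walk t)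
      from s t (inj₁ (inj₁ p)) = share⇒adj (joinsAt walk s) (joinsAt walk t)
        (half s t (inj₁ p)) (inj₂ (inj₁ (cong c p)))
      from s t (inj₁ (inj₂ p)) = share⇒adj (joinsAt walk s) (joinsAt walk t)
        (≢-sym (half t s (inj₁ p))) (inj₁ (inj₂ (cong c (sym p))))
      from s t (inj₂ (inj₁ (p , q))) = share⇒adj (joinsAt walk s) (joinsAt walk t)
        (half s t (inj₂ (p , q))) (inj₁ (inj₂ (trans (cong c p) (trans closed (sym (cong c q))))))
      from s t (inj₂ (inj₂ (p , q))) = share⇒adj (joinsAt walk s) (joinsAt walk t)
        (≢-sym (half t s (inj₂ (p , q)))) (inj₂ (inj₁ (trans (cong c q) (trans (sym closed) (sym (cong c p))))))

    base-unique : ∀ {s} → s ≤ k → c s ≡ c 1 → s ≡ 1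
    base-unique s≤k p with m≤n⇒m<n∨m≡n s≤k
    ... | inj₁ s<k = distinct s<k (≤-trans (s≤s (s≤s z≤n)) long) p
    ... | inj₂ refl with distinct (≤-trans (s≤s z≤n) long) (≤-trans (s≤s (s≤s z≤n)) long) (trans closed p)
    ...   | ()

    at : ∀ {i} → i < 4 → Fin k
    at i<4 = fromℕ< (≤-trans i<4 long)

    toℕ-at : ∀ {i} (i<4 : i < 4) → toℕ (at i<4) ≡ i
    toℕ-at i<4 = toℕ-fromℕ< (≤-trans i<4 long)

    base-adj : Adj G (edgeAt walk (at 0<4)) (edgeAt walk (at 1<4))
    base-adj = Equivalence.from (Hole.edges hole (at 0<4) (at 1<4))
      (inj₁ (inj₁ (trans (cong suc (toℕ-at 0<4)) (sym (toℕ-at 1<4)))))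

    Off : Fin m → Set
    Off x = ∀ {t} → t ≤ k → c t ≢ x

    module _ {f y} (j : Joins f (c 1) y) (off : Off y) where

      pendant≢ : ∀ t → f ≢ edgeAt walk t
      pendant≢ t refl with joins-unique refl j (joinsAt walk t)
      ... | inj₁ (_ , q) = off (toℕ<n t) (sym q)
      ... | inj₂ (_ , q) = off (<⇒≤ (toℕ<n t)) (sym q)

      -- An edge that leaves the cycle at its base point meets just the two cycle edges there. This
      -- serves both for the hat of a clown and for the ends of the path of a handcuff.
      pendant⇔ : ∀ t → Adj G f (edgeAt walk t) ⇔ (toℕ t ≡ 0 ⊎ toℕ t ≡ 1)
      pendant⇔ t = mk⇔ to from
        where
        to : Adj G f (edgeAt walk t) → toℕ t ≡ 0 ⊎ toℕ t ≡ 1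
        to a with adj⇒share j (joinsAt walk t) a
        ... | inj₁ (inj₁ p) = inj₂ (base-unique (<⇒≤ (toℕ<n t)) (sym p))
        ... | inj₁ (inj₂ p) = inj₁ (suc-injective (base-unique (toℕ<n t) (sym p)))
        ... | inj₂ (inj₁ p) = ⊥-elim (off (<⇒≤ (toℕ<n t)) (sym p))
        ... | inj₂ (inj₂ p) = ⊥-elim (off (toℕ<n t) (sym p))
        from : toℕ t ≡ 0 ⊎ toℕ t ≡ 1 → Adj G f (edgeAt walk t)
        from (inj₁ p) = share⇒adj j (joinsAt walk t) (pendant≢ t) (inj₁ (inj₂ (cong (c ∘ suc) (sym p))))
        from (inj₂ p) = share⇒adj j (joinsAt walk t) (pendant≢ t) (inj₁ (inj₁ (cong c (sym p))))

      pendant-nbrs : TwoAdjNbrs G hole f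
      pendant-nbrs = at 0<4 , at 1<4
        , (λ q → 0≢1+n (trans (sym (toℕ-at 0<4)) (trans (cong toℕ q) (toℕ-at 1<4))))
        , base-adj
        , λ t → mk⇔ (λ a → to t (Equivalence.to (pendant⇔ t) a))
                    (λ s → Equivalence.from (pendant⇔ t) (from t s))
        where
        to : ∀ t → toℕ t ≡ 0 ⊎ toℕ t ≡ 1 → t ≡ at 0<4 ⊎ t ≡ at 1<4
        to t (inj₁ p) = inj₁ (toℕ-injective (trans p (sym (toℕ-at 0<4))))
        to t (inj₂ p) = inj₂ (toℕ-injective (trans p (sym (toℕ-at 1<4))))
        from : ∀ t → t ≡ at 0<4 ⊎ t ≡ at 1<4 → toℕ t ≡ 0 ⊎ toℕ t ≡ 1
        from t (inj₁ refl) = inj₁ (toℕ-at 0<4)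
        from t (inj₂ refl) = inj₂ (toℕ-at 1<4)

    off-edge : ∀ {f x y} → Joins f x y → Off x → Off y → ∀ t → f ≢ edgeAt walk t × ¬ Adj G f (edgeAt walk t)
    off-edge {f} {x} {y} j offx offy t = ≢edge , nonadj
      where
      ≢edge : f ≢ edgeAt walk t
      ≢edge refl with joins-unique refl j (joinsAt walk t)
      ... | inj₁ (q , _) = offx (<⇒≤ (toℕ<n t)) (sym q)
      ... | inj₂ (q , _) = offx (toℕ<n t) (sym q)
      nonadj : ¬ Adj G f (edgeAt walk t)
      nonadj a with adj⇒share j (joinsAt walk t) a
      ... | inj₁ (inj₁ p) = offx (<⇒≤ (toℕ<n t)) (sym p)
      ... | inj₁ (inj₂ p) = offx (toℕ<n t) (sym p)
      ... | inj₂ (inj₁ p) = offy (<⇒≤ (toℕ<n t)) (sym p)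
      ... | inj₂ (inj₂ p) = offy (toℕ<n t) (sym p)

  -- Forbidden configurations

  -- The first and the last edge of the trail are pendant at the base points of the two cycles.
  -- Relative to either cycle, every other edge of the trail and every edge of the other cycle has
  -- both ends off it, hence causes no further adjacency.
  handcuff : ∀ {k c k′ c′ r p} (C : Cycle k c) (C′ : Cycle k′ c′) (T : Trail (suc r) p) →
    p 0 ≡ c 1 → p (suc r) ≡ c′ 1 →
    (∀ {s t} → s ≤ k → t ≤ k′ → c s ≢ c′ t) →
    (∀ {s t} → s ≤ suc r → t ≤ k → c t ≡ p s → s ≡ 0) →
    (∀ {s t} → s ≤ suc r → t ≤ k′ → c′ t ≡ p s → s ≡ suc r) →
    Odd r → Handcuff G
  handcuff {k} {c} {k′} {c′} {r} {p} C C′ T start end disj meet₁ meet₂ odd = record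
    { k₁ = k ; k₂ = k′ ; r = r
    ; C₁ = Cycle.hole C ; C₂ = Cycle.hole C′
    ; even₁ = Cycle.even C ; even₂ = Cycle.even C′
    ; P = trailPath T ; oddP = odd
    ; disj₁₂ = λ s t → proj₁ (off₁₂ s t)
    ; disjP₁ = disjP₁
    ; disjP₂ = disjP₂
    ; anti₁₂ = λ s t → proj₂ (off₁₂ s t)
    ; end₁ = Cycle.pendant-nbrs C first-joins off-first
    ; end₂ = Cycle.pendant-nbrs C′ last-joins off-last
    ; antiP₁ = λ s t s≢0 → proj₂ (offP₁ s s≢0 t)
    ; antiP₂ = λ s t s≢r → proj₂ (offP₂ s s≢r t) }
    where
    open Trail T using (walk)
    off₁₂ : ∀ s t → edgeAt (Cycle.walk C) s ≢ edgeAt (Cycle.walk C′) t × ¬ Adj G (edgeAt (Cycle.walk C) s) (edgeAt (Cycle.walk C′) t)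
    off₁₂ s t = Cycle.off-edge C′ (joinsAt (Cycle.walk C) s)
      (λ t≤ q → disj (<⇒≤ (toℕ<n s)) t≤ (sym q)) (λ t≤ q → disj (toℕ<n s) t≤ (sym q)) t
    first-joins : Joins (edgeAt walk zero) (c 1) (p 1)
    first-joins = subst (λ x → Joins (edgeAt walk zero) x (p 1)) start (joinsAt walk zero)
    off-first : Cycle.Off C (p 1)
    off-first t≤k q with meet₁ (s≤s z≤n) t≤k q
    ... | ()
    last-joins : Joins (edgeAt walk (fromℕ r)) (c′ 1) (p r)
    last-joins = joins-sym (subst₂ (Joins (edgeAt walk (fromℕ r))) (cong p (toℕ-fromℕ r))
      (trans (cong (p ∘ suc) (toℕ-fromℕ r)) end) (joinsAt walk (fromℕ r)))
    off-last : Cycle.Off C′ (p r)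
    off-last t≤k q = 1+n≢n (sym (meet₂ (n≤1+n r) t≤k q))
    offP₁ : ∀ s → toℕ s ≢ 0 → ∀ t → edgeAt walk s ≢ edgeAt (Cycle.walk C) t × ¬ Adj G (edgeAt walk s) (edgeAt (Cycle.walk C) t)
    offP₁ s s≢0 = Cycle.off-edge C (joinsAt walk s)
      (λ t≤ q → s≢0 (meet₁ (<⇒≤ (toℕ<n s)) t≤ q)) (λ t≤ q → 1+n≢0 (meet₁ (toℕ<n s) t≤ q))
    offP₂ : ∀ s → toℕ s ≢ r → ∀ t → edgeAt walk s ≢ edgeAt (Cycle.walk C′) t × ¬ Adj G (edgeAt walk s) (edgeAt (Cycle.walk C′) t)
    offP₂ s s≢r = Cycle.off-edge C′ (joinsAt walk s)
      (λ t≤ q → <⇒≢ (toℕ<n s) (meet₂ (<⇒≤ (toℕ<n s)) t≤ q)) (λ t≤ q → s≢r (suc-injective (meet₂ (toℕ<n s) t≤ q)))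
    disjP₁ : ∀ s t → edgeAt walk s ≢ edgeAt (Cycle.walk C) t
    disjP₁ zero t = Cycle.pendant≢ C first-joins off-first t
    disjP₁ (suc s) t = proj₁ (offP₁ (suc s) (λ ()) t)
    disjP₂ : ∀ s t → edgeAt walk s ≢ edgeAt (Cycle.walk C′) t
    disjP₂ s t with toℕ s ≟ r
    ... | no s≢r = proj₁ (offP₂ s s≢r t)
    ... | yes s≡r with toℕ-injective {i = s} {fromℕ r} (trans s≡r (sym (toℕ-fromℕ r)))
    ...   | refl = Cycle.pendant≢ C′ last-joins off-last t

  -- The cycles share only their base point, where the edges 0 and 1 of each cycle meet. These two
  -- pairs are the edges complete to each other.
  eyeMask : ∀ {k c k′ c′} (C : Cycle k c) (C′ : Cycle k′ c′) → c 1 ≡ c′ 1 →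
    (∀ {s t} → s ≤ k → t ≤ k′ → c s ≡ c′ t → c s ≡ c 1) → EyeMask G
  eyeMask {k} {c} {k′} {c′} C C′ base meet = record
    { k₁ = k ; k₂ = k′
    ; C₁ = C.hole ; C₂ = C′.hole
    ; even₁ = C.even ; even₂ = C′.even
    ; disj = disj
    ; x₁ = C.at 0<4 ; y₁ = C.at 1<4 ; x₂ = C′.at 0<4 ; y₂ = C′.at 1<4
    ; edge₁ = C.base-adj ; edge₂ = C′.base-adj
    ; between = λ s t → mk⇔ (to s t) (from s t) }
    where
    module C = Cycle C
    module C′ = Cycle C′
    idx : ∀ {s t} → s ≤ k → t ≤ k′ → c s ≡ c′ t → s ≡ 1 × t ≡ 1
    idx s≤ t≤ p = C.base-unique s≤ q , C′.base-unique t≤ (trans (sym p) (trans q base))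
      where q = meet s≤ t≤ p
    disj : ∀ s t → edgeAt C.walk s ≢ edgeAt C′.walk t
    disj s t eq with joins-unique eq (joinsAt C.walk s) (joinsAt C′.walk t)
    ... | inj₁ (p , q) = 1+n≢n (trans (proj₁ (idx (toℕ<n s) (toℕ<n t) q)) (sym (proj₁ (idx (<⇒≤ (toℕ<n s)) (<⇒≤ (toℕ<n t)) p))))
    ... | inj₂ (p , q) = 1+n≢n (trans (proj₁ (idx (toℕ<n s) (<⇒≤ (toℕ<n t)) q)) (sym (proj₁ (idx (<⇒≤ (toℕ<n s)) (toℕ<n t) p))))
    near : ∀ s → s ≡ C.at 0<4 ⊎ s ≡ C.at 1<4 → c (toℕ s) ≡ c 1 ⊎ c (suc (toℕ s)) ≡ c 1
    near s (inj₁ refl) = inj₂ (cong (c ∘ suc) (C.toℕ-at 0<4))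
    near s (inj₂ refl) = inj₁ (cong c (C.toℕ-at 1<4))
    near′ : ∀ t → t ≡ C′.at 0<4 ⊎ t ≡ C′.at 1<4 → c′ (toℕ t) ≡ c′ 1 ⊎ c′ (suc (toℕ t)) ≡ c′ 1
    near′ t (inj₁ refl) = inj₂ (cong (c′ ∘ suc) (C′.toℕ-at 0<4))
    near′ t (inj₂ refl) = inj₁ (cong c′ (C′.toℕ-at 1<4))
    at₀ : ∀ s → suc (toℕ s) ≡ 1 → s ≡ C.at 0<4
    at₀ s p = toℕ-injective (trans (suc-injective p) (sym (C.toℕ-at 0<4)))
    at₁ : ∀ s → toℕ s ≡ 1 → s ≡ C.at 1<4
    at₁ s p = toℕ-injective (trans p (sym (C.toℕ-at 1<4)))
    at₀′ : ∀ t → suc (toℕ t) ≡ 1 → t ≡ C′.at 0<4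
    at₀′ t p = toℕ-injective (trans (suc-injective p) (sym (C′.toℕ-at 0<4)))
    at₁′ : ∀ t → toℕ t ≡ 1 → t ≡ C′.at 1<4
    at₁′ t p = toℕ-injective (trans p (sym (C′.toℕ-at 1<4)))
    to : ∀ s t → Adj G (edgeAt C.walk s) (edgeAt C′.walk t) →
      (s ≡ C.at 0<4 ⊎ s ≡ C.at 1<4) × (t ≡ C′.at 0<4 ⊎ t ≡ C′.at 1<4)
    to s t a with adj⇒share (joinsAt C.walk s) (joinsAt C′.walk t) a
    ... | inj₁ (inj₁ p) with idx (<⇒≤ (toℕ<n s)) (<⇒≤ (toℕ<n t)) p
    ...   | x , y = inj₂ (at₁ s x) , inj₂ (at₁′ t y)
    to s t a | inj₁ (inj₂ p) with idx (<⇒≤ (toℕ<n s)) (toℕ<n t) p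
    ...   | x , y = inj₂ (at₁ s x) , inj₁ (at₀′ t y)
    to s t a | inj₂ (inj₁ p) with idx (toℕ<n s) (<⇒≤ (toℕ<n t)) p
    ...   | x , y = inj₁ (at₀ s x) , inj₂ (at₁′ t y)
    to s t a | inj₂ (inj₂ p) with idx (toℕ<n s) (toℕ<n t) p
    ...   | x , y = inj₁ (at₀ s x) , inj₁ (at₀′ t y)
    from : ∀ s t → (s ≡ C.at 0<4 ⊎ s ≡ C.at 1<4) × (t ≡ C′.at 0<4 ⊎ t ≡ C′.at 1<4) →
      Adj G (edgeAt C.walk s) (edgeAt C′.walk t)
    from s t (a , b) = share⇒adj (joinsAt C.walk s) (joinsAt C′.walk t) (disj s t) (share (near s a) (near′ t b))
      where
      share : c (toℕ s) ≡ c 1 ⊎ c (suc (toℕ s)) ≡ c 1 → c′ (toℕ t) ≡ c′ 1 ⊎ c′ (suc (toℕ t)) ≡ c′ 1 →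
        ShareEnd (c (toℕ s) , c (suc (toℕ s))) (c′ (toℕ t) , c′ (suc (toℕ t)))
      share (inj₁ p) (inj₁ q) = inj₁ (inj₁ (trans p (trans base (sym q))))
      share (inj₁ p) (inj₂ q) = inj₁ (inj₂ (trans p (trans base (sym q))))
      share (inj₂ p) (inj₁ q) = inj₂ (inj₁ (trans p (trans base (sym q))))
      share (inj₂ p) (inj₂ q) = inj₂ (inj₂ (trans p (trans base (sym q))))

  -- A path of the theta graph whose line graph is a prism. `r` is the length of the path in `G`, so
  -- the arc has an even number `suc r` of edges.
  record Arc (u t : Fin m) : Set where
    field
      {r}   : ℕ
      {v}   : ℕ → Fin m
      trail : Trail (suc r) v
      start : v 0 ≡ u
      end   : v (suc r) ≡ t
      odd   : Odd r

  OnArc : ∀ {u t} → Arc u t → Fin m → Set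
  OnArc A x = ∃ λ s → s ≤ suc (Arc.r A) × Arc.v A s ≡ x

  InternallyDisjoint : ∀ {u t} → Arc u t → Arc u t → Set
  InternallyDisjoint {u} {t} A B = ∀ {x} → OnArc A x → OnArc B x → x ≡ u ⊎ x ≡ t

  -- The three first edges meet at `u` and the three last edges at `t`, which gives the two
  -- triangles. Two arcs have no other vertex in common, so there are no other adjacencies between
  -- their edges.
  theta⇒prism : ∀ {u t} (A : Fin 3 → Arc u t) →
    (∀ i j → i ≢ j → InternallyDisjoint (A i) (A j)) → OddPrism G
  theta⇒prism {u} {t} A internally = record
    { len = λ i → Arc.r (A i)
    ; paths = λ i → trailPath (Arc.trail (A i))
    ; nontriv = λ i → odd⇒pos (Arc.odd (A i))
    ; disjoint = disjoint
    ; between = λ i j i≢j s q → mk⇔ (to i j i≢j s q) (from i j i≢j s q) } , λ i → Arc.odd (A i)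
    where
    odd⇒pos : ∀ {k} → Odd k → 1 ≤ k
    odd⇒pos (_ , refl) = s≤s z≤n
    module A i = Arc (A i)
    walk : ∀ i → Walk (suc (A.r i)) (A.v i)
    walk i = Trail.walk (A.trail i)
    at-start : ∀ i {s} → s ≤ suc (A.r i) → A.v i s ≡ u → s ≡ 0
    at-start i s≤ p = Trail.distinct (A.trail i) s≤ z≤n (trans p (sym (A.start i)))
    at-end : ∀ i {s} → s ≤ suc (A.r i) → A.v i s ≡ t → s ≡ suc (A.r i)
    at-end i s≤ p = Trail.distinct (A.trail i) s≤ ≤-refl (trans p (sym (A.end i)))
    idx : ∀ i j → i ≢ j → ∀ {s q} → s ≤ suc (A.r i) → q ≤ suc (A.r j) → A.v i s ≡ A.v j q →
      (s ≡ 0 × q ≡ 0) ⊎ (s ≡ suc (A.r i) × q ≡ suc (A.r j))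
    idx i j i≢j {s} {q} s≤ q≤ p with internally i j i≢j (s , s≤ , p) (q , q≤ , refl)
    ... | inj₁ x = inj₁ (at-start i s≤ (trans p x) , at-start j q≤ x)
    ... | inj₂ x = inj₂ (at-end i s≤ (trans p x) , at-end j q≤ x)
    mixed : ∀ i j → i ≢ j → ∀ (s : Fin (suc (A.r i))) (q : Fin (suc (A.r j))) →
      A.v i (toℕ s) ≢ A.v j (suc (toℕ q))
    mixed i j i≢j s q p with idx i j i≢j (<⇒≤ (toℕ<n s)) (toℕ<n q) p
    ... | inj₂ (x , _) = <⇒≢ (toℕ<n s) x
    disjoint : ∀ i j → i ≢ j → ∀ s q → edgeAt (walk i) s ≢ edgeAt (walk j) q
    disjoint i j i≢j s q eq with joins-unique eq (joinsAt (walk i) s) (joinsAt (walk j) q)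
    ... | inj₂ (x , _) = mixed i j i≢j s q x
    ... | inj₁ (x , y) with idx i j i≢j (<⇒≤ (toℕ<n s)) (<⇒≤ (toℕ<n q)) x | idx i j i≢j (toℕ<n s) (toℕ<n q) y
    ...   | inj₂ (a , _) | _ = <⇒≢ (toℕ<n s) a
    -- An edge common to two arcs would join `u` directly to `t`, but an arc of odd `r` has at least
    -- two edges.
    ...   | inj₁ (a , _) | inj₂ (b , _) = n≮0 (subst (0 <_) (trans (sym (suc-injective b)) a) (odd⇒pos (A.odd i)))
    to : ∀ i j → i ≢ j → ∀ s q → Adj G (edgeAt (walk i) s) (edgeAt (walk j) q) →
      (toℕ s ≡ 0 × toℕ q ≡ 0) ⊎ (toℕ s ≡ A.r i × toℕ q ≡ A.r j)
    to i j i≢j s q a with adj⇒share (joinsAt (walk i) s) (joinsAt (walk j) q) a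
    to i j i≢j s q a | inj₁ (inj₂ p) = ⊥-elim (mixed i j i≢j s q p)
    to i j i≢j s q a | inj₂ (inj₁ p) = ⊥-elim (mixed j i (≢-sym i≢j) q s (sym p))
    to i j i≢j s q a | inj₁ (inj₁ p) with idx i j i≢j (<⇒≤ (toℕ<n s)) (<⇒≤ (toℕ<n q)) p
    ... | inj₁ x = inj₁ x
    ... | inj₂ (x , _) = ⊥-elim (<⇒≢ (toℕ<n s) x)
    to i j i≢j s q a | inj₂ (inj₂ p) with idx i j i≢j (toℕ<n s) (toℕ<n q) p
    ... | inj₂ (x , y) = inj₂ (suc-injective x , suc-injective y)
    from : ∀ i j → i ≢ j → ∀ s q → (toℕ s ≡ 0 × toℕ q ≡ 0) ⊎ (toℕ s ≡ A.r i × toℕ q ≡ A.r j) →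
      Adj G (edgeAt (walk i) s) (edgeAt (walk j) q)
    from i j i≢j s q (inj₁ (x , y)) = share⇒adj (joinsAt (walk i) s) (joinsAt (walk j) q) (disjoint i j i≢j s q)
      (inj₁ (inj₁ (trans (trans (cong (A.v i) x) (A.start i)) (sym (trans (cong (A.v j) y) (A.start j))))))
    from i j i≢j s q (inj₂ (x , y)) = share⇒adj (joinsAt (walk i) s) (joinsAt (walk j) q) (disjoint i j i≢j s q)
      (inj₂ (inj₂ (trans (trans (cong (A.v i ∘ suc) x) (A.end i)) (sym (trans (cong (A.v j ∘ suc) y) (A.end j))))))

  -- Trails with anchored ends

  reversed : ℕ → (ℕ → Fin m) → ℕ → Fin m
  reversed n w i = w (n ∸ i)

  reversed-involutive : ∀ {n i} w → i ≤ n → reversed n (reversed n w) i ≡ w i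
  reversed-involutive w i≤n = cong w (m∸[m∸n]≡n i≤n)

  reversed-last : ∀ n w → reversed n w n ≡ w 0
  reversed-last n w = cong w (n∸n≡0 n)

  reversed-trail : ∀ {n w} → Trail n w → Trail n (reversed n w)
  reversed-trail {n} {w} T = record
    { walk = λ i i<n → link-sym (subst (λ x → Link (w (n ∸ suc i)) (w x)) (suc-∸ i<n) (T.walk (n ∸ suc i) (∸-monoʳ-< (s≤s z≤n) i<n)))
    ; distinct = λ {i} {j} i≤n j≤n p → ∸-cancelˡ-≡ i≤n j≤n (T.distinct (m∸n≤m n i) (m∸n≤m n j) p) }
    where
    module T = Trail T
    suc-∸ : ∀ {i} → i < n → suc (n ∸ suc i) ≡ n ∸ i
    suc-∸ i<n = sym (+-∸-assoc 1 i<n)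

  segment : ∀ {n w} j d → j + d ≤ n → Trail n w → Trail d (λ t → w (j + t))
  segment {n} {w} j d le T = record
    { walk = λ i i<d → subst (λ x → Link (w (j + i)) (w x)) (sym (+-suc j i))
        (T.walk (j + i) (≤-trans (+-monoʳ-< j i<d) le))
    ; distinct = λ i≤d i′≤d p → +-cancelˡ-≡ j _ _
        (T.distinct (≤-trans (+-monoʳ-≤ j i≤d) le) (≤-trans (+-monoʳ-≤ j i′≤d) le) p) }
    where module T = Trail T

  -- The cycle formed by the segment from `w j` to `w (j + d)` and a chord between its ends. It
  -- crosses the chord first, so that index 1, the base point, is `w j`, where the rest of the trail
  -- is attached.
  lassoVertex : (ℕ → Fin m) → ℕ → ℕ → ℕ → Fin m
  lassoVertex w j d zero = w (j + d)
  lassoVertex w j d (suc t) = w (j + t)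

  module _ {w j d} (T : Trail (j + d) w) where

    lasso : 2 ≤ d → Link (w (j + d)) (w j) → Cycle (suc d) (lassoVertex w j d)
    lasso 2≤d chord = record
      -- A triangle, the one short case left by `2 ≤ d`, is excluded because the closed walk has
      -- even length.
      { long = s≤s (at-least-three 2≤d (walk-even {v = lassoVertex w j d} walk refl))
      ; closed = refl
      ; walk = walk
      ; distinct = distinct }
      where
      S : Trail d (λ t → w (j + t))
      S = segment j d ≤-refl T
      walk : Walk (suc d) (lassoVertex w j d)
      walk zero _ = subst (λ x → Link (w (j + d)) (w x)) (sym (+-identityʳ j)) chord
      walk (suc t) (s≤s t<d) = Trail.walk S t t<d
      distinct : ∀ {s t} → s < suc d → t < suc d → lassoVertex w j d s ≡ lassoVertex w j d t → s ≡ t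
      distinct {zero} {zero} _ _ _ = refl
      distinct {zero} {suc t} _ (s≤s t<d) p = ⊥-elim (<⇒≢ t<d (sym (Trail.distinct S ≤-refl (<⇒≤ t<d) p)))
      distinct {suc s} {zero} (s≤s s<d) _ p = ⊥-elim (<⇒≢ s<d (Trail.distinct S (<⇒≤ s<d) ≤-refl p))
      distinct {suc s} {suc t} (s≤s s<d) (s≤s t<d) p = cong suc (Trail.distinct S (<⇒≤ s<d) (<⇒≤ t<d) p)
      at-least-three : ∀ {d} → 2 ≤ d → Even (suc d) → 3 ≤ d
      at-least-three {suc (suc zero)} _ e = ⊥-elim (even⇒¬odd e (1 , refl))
      at-least-three {suc (suc (suc _))} _ _ = s≤s (s≤s (s≤s z≤n))
      at-least-three {suc zero} (s≤s ()) _

    lasso-range : ∀ {t} → t ≤ suc d → ∃ λ x → j ≤ x × x ≤ j + d × lassoVertex w j d t ≡ w x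
    lasso-range {zero} _ = j + d , m≤m+n j d , ≤-refl , refl
    lasso-range {suc t} (s≤s t≤d) = j + t , m≤m+n j t , +-monoʳ-≤ j t≤d , refl

  reverse-arc : ∀ {u t} → Arc u t → Arc t u
  reverse-arc A = record
    { trail = reversed-trail A.trail
    ; start = A.end
    ; end = trans (reversed-last (suc A.r) A.v) A.start
    ; odd = A.odd }
    where module A = Arc A

  reverse-arc-on : ∀ {u t} (A : Arc u t) {x} → OnArc (reverse-arc A) x → OnArc A x
  reverse-arc-on A (s , s≤ , p) = suc (Arc.r A) ∸ s , m∸n≤m (suc (Arc.r A)) s , p

  -- Crosses the chord from `w i` to `w 0` and then follows the trail up to `w j`.
  detourVertex : (ℕ → Fin m) → ℕ → ℕ → Fin m
  detourVertex w i zero = w i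
  detourVertex w i (suc t) = w t

  module _ {n w i j} (T : Trail n w) (j<i : j < i) (i≤n : i ≤ n)
    (chord : Link (w 0) (w i)) (same : side (w i) ≡ side (w j)) where

    detour : Arc (w i) (w j)
    detour = record
      { trail = record { walk = walk ; distinct = distinct }
      ; start = refl
      ; end = refl
      ; odd = even-suc (walk-even {v = detourVertex w i} walk same) }
      where
      j≤n : j ≤ n
      j≤n = ≤-trans (<⇒≤ j<i) i≤n
      walk : Walk (suc j) (detourVertex w i)
      walk zero _ = link-sym chord
      walk (suc t) (s≤s t<j) = Trail.walk T t (≤-trans t<j j≤n)
      distinct : ∀ {s t} → s ≤ suc j → t ≤ suc j → detourVertex w i s ≡ detourVertex w i t → s ≡ t
      distinct {zero} {zero} _ _ _ = refl
      distinct {zero} {suc t} _ (s≤s t≤j) p =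
        ⊥-elim (<⇒≢ (≤-<-trans t≤j j<i) (sym (Trail.distinct T i≤n (≤-trans t≤j j≤n) p)))
      distinct {suc s} {zero} (s≤s s≤j) _ p =
        ⊥-elim (<⇒≢ (≤-<-trans s≤j j<i) (Trail.distinct T (≤-trans s≤j j≤n) i≤n p))
      distinct {suc s} {suc t} (s≤s s≤j) (s≤s t≤j) p = cong suc (Trail.distinct T (≤-trans s≤j j≤n) (≤-trans t≤j j≤n) p)

    detour-range : ∀ {x} → OnArc detour x → ∃ λ y → (y ≤ j ⊎ y ≡ i) × w y ≡ x
    detour-range (zero , _ , p) = i , inj₂ refl , p
    detour-range (suc t , s≤s t≤j , p) = t , inj₁ t≤j , p

  -- `only` bounds the neighbours of `v` and not its edges: edges parallel to `z` may exist, and it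
  -- is canonicity that singles out `z` among them.
  record ZLeaf (v : Fin m) : Set where
    field
      {z u} : _
      z∈Z   : z ∈ Z
      joins : Joins z v u
      only  : ∀ {e x} → Joins e v x → x ≡ u

    unique-edge : ∀ {x} (l : Link x v) → Link.edge l ≡ z
    unique-edge (link e j canonical) with only (joins-sym j)
    ... | refl = sym (canonical z z∈Z j (joins-sym joins))

  -- The bound 2 keeps a chord from being parallel to the end edge of the trail. `RightChord` splits
  -- `n` as `j + d`, the form in which `lasso` takes the length.
  LeftChord RightChord LeftAnchor RightAnchor : ℕ → (ℕ → Fin m) → Set
  LeftChord n w = ∃ λ i → 2 ≤ i × i ≤ n × Link (w 0) (w i)
  RightChord n w = ∃ λ j → ∃ λ d → 2 ≤ d × j + d ≡ n × Link (w n) (w j)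
  LeftAnchor n w = ZLeaf (w 0) ⊎ LeftChord n w
  RightAnchor n w = ZLeaf (w n) ⊎ RightChord n w

  reversed-chord : ∀ {n w} → LeftChord n w → RightChord n (reversed n w)
  reversed-chord {n} {w} (i , 2≤i , i≤n , l) =
    n ∸ i , i , 2≤i , m∸n+n≡m i≤n , subst₂ Link (sym (reversed-last n w)) (sym (reversed-involutive w i≤n)) l

  reversed-anchor : ∀ {n w} → LeftAnchor n w → RightAnchor n (reversed n w)
  reversed-anchor {n} {w} (inj₁ leaf) = inj₁ (subst ZLeaf (sym (reversed-last n w)) leaf)
  reversed-anchor {n} {w} (inj₂ chord) = inj₂ (reversed-chord {n} {w} chord)

  module Refutation (candidate : Candidate G Z) where

    private
      innocent = proj₁ (proj₂ candidate)
      noOddPrism = proj₁ (proj₂ (proj₂ innocent))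
      noHandcuff = proj₁ (proj₂ (proj₂ (proj₂ innocent)))
      noEyeMask = proj₂ (proj₂ (proj₂ (proj₂ innocent)))
      consistent = proj₁ (proj₂ (proj₂ candidate))
      safe = proj₁ (proj₂ (proj₂ (proj₂ candidate)))

    -- Trails anchored at both ends contradict consistency, safety or innocence

    last-edge : ∀ {r v} (T : Trail (suc r) v) (leaf : ZLeaf (v (suc r))) → Path.last (trailPath T) ≡ ZLeaf.z leaf
    last-edge {r} {v} T leaf = go (toℕ-fromℕ r) (toℕ<n (fromℕ r))
      where
      go : ∀ {s} → s ≡ r → (s<r : s < suc r) → Link.edge (Trail.walk T s s<r) ≡ ZLeaf.z leaf
      go refl s<r = ZLeaf.unique-edge leaf (Trail.walk T r s<r)

    -- With both ends on one side, `suc r` would be even, and the trail would be a path of odd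
    -- length `r` between two members of `Z`.
    leaf-leaf : ∀ {r v} → Trail (suc r) v → ZLeaf (v 0) → ZLeaf (v (suc r)) → side (v 0) ≢ side (v (suc r))
    leaf-leaf {r} T leaf leaf′ p = even⇒¬odd
      (consistent _ _ (ZLeaf.z∈Z leaf) (ZLeaf.z∈Z leaf′) r (trailPath T)
        (inj₁ (ZLeaf.unique-edge leaf (link-sym (Trail.walk T 0 (s≤s z≤n))) , last-edge T leaf′)))
      (even-suc (walk-even (Trail.walk T) p))

    -- The first edge of the trail is the hat of a clown on the cycle, and the later edges are away
    -- from the cycle. Safety of the edge at the leaf therefore makes `r` odd, so the trail has an
    -- even number of edges.
    leaf-cycle : ∀ {k c r p} (C : Cycle k c) (T : Trail (suc r) p) → p 0 ≡ c 1 →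
      (∀ {s t} → s ≤ suc r → t ≤ k → c t ≡ p s → s ≡ 0) →
      ZLeaf (p (suc r)) → side (p 0) ≡ side (p (suc r))
    leaf-cycle {k} {c} {r} {p} C T start meet leaf with side (p 0) Data.Bool.≟ side (p (suc r))
    ... | yes eq = eq
    ... | no neq = ⊥-elim (even⇒¬odd (odd-suc path-odd) (walk-odd walk neq))
      where
      open Trail T using (walk)
      odd-suc : ∀ {k} → Odd k → Even (suc k)
      odd-suc (a , refl) = suc a , cong suc (sym (+-suc a a))
      first-joins : Joins (edgeAt walk zero) (c 1) (p 1)
      first-joins = subst (λ x → Joins (edgeAt walk zero) x (p 1)) start (joinsAt walk zero)
      off-first : Cycle.Off C (p 1)
      off-first t≤k q with meet (s≤s z≤n) t≤k q
      ... | ()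
      D : Clown G
      D = record
        { k = k ; hat = edgeAt walk zero ; C = Cycle.hole C ; evenC = Cycle.even C
        ; hatOut = Cycle.pendant≢ C first-joins off-first
        ; hatAdj = Cycle.pendant⇔ C first-joins off-first }
      away : ∀ s → edgeAt walk s ≢ edgeAt walk zero → ∀ t →
        edgeAt walk s ≢ edgeAt (Cycle.walk C) t × ¬ Adj G (edgeAt walk s) (edgeAt (Cycle.walk C) t)
      away zero ne = ⊥-elim (ne refl)
      away (suc s) _ = Cycle.off-edge C (joinsAt walk (suc s))
        (λ t≤ q → 1+n≢0 (meet (<⇒≤ (toℕ<n (suc s))) t≤ q)) (λ t≤ q → 1+n≢0 (meet (toℕ<n (suc s)) t≤ q))
      path-odd : Odd r
      path-odd = proj₂ (safe _ (ZLeaf.z∈Z leaf)) D r (trailPath T) (inj₂ (refl , last-edge T leaf)) away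

    -- The chord closes a lasso with base point `w j`, and the trail leads from there back to the
    -- leaf `w 0`. By `leaf-cycle` the vertex `w j` is on the side of `w 0`, hence of `w n`,
    -- although the chord joins it to `w n`. If `j` is 0, the chord itself joins two vertices of one
    -- side.
    leaf-chord : ∀ {n w} → Trail n w → side (w 0) ≡ side (w n) → ZLeaf (w 0) → ¬ RightChord n w
    leaf-chord T p leaf (zero , d , 2≤d , refl , chord) = link-side chord (sym p)
    leaf-chord {n} {w} T p leaf (suc r , d , 2≤d , refl , chord) =
      link-side chord (trans (sym p) (sym (trans
        (leaf-cycle (lasso T 2≤d chord) (reversed-trail (segment 0 (suc r) (m≤m+n (suc r) d) T))
          (cong w (sym (+-identityʳ (suc r)))) meet (subst ZLeaf (sym (reversed-last (suc r) w)) leaf))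
        (cong side (reversed-last (suc r) w)))))
      where
      meet : ∀ {s t} → s ≤ suc r → t ≤ suc d → lassoVertex w (suc r) d t ≡ w (suc r ∸ s) → s ≡ 0
      meet {zero} _ _ _ = refl
      meet {suc s} _ t≤ q with lasso-range {w} {suc r} {d} T t≤
      ... | x , j≤x , x≤n , eq with Trail.distinct T x≤n (≤-trans (m∸n≤m r s) (≤-trans (n≤1+n r) (m≤m+n (suc r) d))) (trans (sym eq) q)
      ...   | refl = ⊥-elim (<⇒≱ j≤x (m∸n≤m r s))

    -- The left lasso covers the indices up to `i`, the right one those from `j` on. They are
    -- disjoint, meet in one vertex or overlap in a segment according to the order of `i` and `j`.
    -- Both `w i` and `w j` lie opposite to the ends of the trail, so trails between them have
    -- evenly many edges.
    chord-chord : ∀ {n w} → Trail n w → side (w 0) ≡ side (w n) → LeftChord n w → ¬ RightChord n w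
    chord-chord {w = w} T p (i , 2≤i , i≤n , chordˡ) (j , d , 2≤d , refl , chordʳ) = by-order (<-cmp i j)
      where
      n = j + d
      T̅ : Trail n (reversed n w)
      T̅ = reversed-trail T
      same : side (w i) ≡ side (w j)
      same = ≢-≢⇒≡ (≢-sym (link-side chordˡ)) (λ q → link-side chordʳ (trans (sym p) q))
      j≤n : j ≤ n
      j≤n = m≤m+n j d
      i̅ = n ∸ i
      i̅+i : i̅ + i ≡ n
      i̅+i = m∸n+n≡m i≤n
      -- The left lasso is built as a right lasso of the reversed trail, where `w i` has index
      -- `n ∸ i`.
      wˡ : ℕ → Fin m
      wˡ = reversed n w
      chordˡ′ : Link (wˡ (i̅ + i)) (wˡ i̅)
      chordˡ′ = subst₂ Link (sym (trans (cong wˡ i̅+i) (reversed-last n w))) (sym (reversed-involutive w i≤n)) chordˡ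
      Tˡ : Trail (i̅ + i) wˡ
      Tˡ = subst (λ k → Trail k wˡ) (sym i̅+i) T̅
      cˡ cʳ : ℕ → Fin m
      cˡ = lassoVertex wˡ i̅ i
      cʳ = lassoVertex w j d
      Cˡ : Cycle (suc i) cˡ
      Cˡ = lasso Tˡ 2≤i chordˡ′
      Cʳ : Cycle (suc d) cʳ
      Cʳ = lasso T 2≤d chordʳ
      rangeˡ : ∀ {t} → t ≤ suc i → ∃ λ x → x ≤ i × cˡ t ≡ w x
      rangeˡ t≤ with lasso-range {wˡ} {i̅} {i} Tˡ t≤
      ... | x , i̅≤x , _ , eq = n ∸ x , subst (n ∸ x ≤_) (m∸[m∸n]≡n i≤n) (∸-monoʳ-≤ n i̅≤x) , eq
      rangeʳ : ∀ {t} → t ≤ suc d → ∃ λ x → j ≤ x × x ≤ n × cʳ t ≡ w x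
      rangeʳ = lasso-range {w} {j} {d} T
      baseˡ : cˡ 1 ≡ w i
      baseˡ = trans (cong wˡ (+-identityʳ i̅)) (reversed-involutive w i≤n)
      baseʳ : cʳ 1 ≡ w j
      baseʳ = cong w (+-identityʳ j)
      distinct = Trail.distinct T

      common : ∀ {s t} → s ≤ suc i → t ≤ suc d → cˡ s ≡ cʳ t → ∃ λ x → j ≤ x × x ≤ i × cˡ s ≡ w x
      common s≤ t≤ q with rangeˡ s≤ | rangeʳ t≤
      ... | x , x≤i , eq | y , j≤y , y≤n , eq′ with distinct (≤-trans x≤i i≤n) y≤n (trans (sym eq) (trans q eq′))
      ...   | refl = x , j≤y , x≤i , eq

      i<j⇒⊥ : i < j → ⊥
      i<j⇒⊥ i<j = noHandcuff (handcuff Cˡ Cʳ S start end disj meetˡ meetʳ odd)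
        where
        -- The number of vertices strictly between `w i` and `w j`; the connecting trail has one
        -- edge more.
        r = j ∸ suc i
        i+ : i + suc r ≡ j
        i+ = trans (+-suc i r) (m+[n∸m]≡n i<j)
        S : Trail (suc r) (λ t → w (i + t))
        S = segment i (suc r) (≤-trans (≤-reflexive i+) j≤n) T
        start = trans (cong w (+-identityʳ i)) (sym baseˡ)
        end = trans (cong w i+) (sym baseʳ)
        odd : Odd r
        odd = even-suc (walk-even (Trail.walk S)
          (trans (cong (side ∘ w) (+-identityʳ i)) (trans same (cong (side ∘ w) (sym i+)))))
        disj : ∀ {s t} → s ≤ suc i → t ≤ suc d → cˡ s ≢ cʳ t
        disj s≤ t≤ q with common s≤ t≤ q
        ... | x , j≤x , x≤i , _ = <⇒≱ i<j (≤-trans j≤x x≤i)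
        bound : ∀ {s} → s ≤ suc r → i + s ≤ n
        bound s≤ = ≤-trans (≤-trans (+-monoʳ-≤ i s≤) (≤-reflexive i+)) j≤n
        meetˡ : ∀ {s t} → s ≤ suc r → t ≤ suc i → cˡ t ≡ w (i + s) → s ≡ 0
        meetˡ {s} s≤ t≤ q with rangeˡ t≤
        ... | x , x≤i , eq with distinct (≤-trans x≤i i≤n) (bound s≤) (trans (sym eq) q)
        ...   | refl = n≤0⇒n≡0 (+-cancelˡ-≤ i s 0 (≤-trans x≤i (≤-reflexive (sym (+-identityʳ i)))))
        meetʳ : ∀ {s t} → s ≤ suc r → t ≤ suc d → cʳ t ≡ w (i + s) → s ≡ suc r
        meetʳ {s} s≤ t≤ q with rangeʳ t≤
        ... | x , j≤x , x≤n , eq with distinct x≤n (bound s≤) (trans (sym eq) q)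
        ...   | refl = ≤-antisym s≤ (+-cancelˡ-≤ i (suc r) s (≤-trans (≤-reflexive i+) j≤x))

      i≡j⇒⊥ : i ≡ j → ⊥
      i≡j⇒⊥ i≡j = noEyeMask (eyeMask Cˡ Cʳ (trans baseˡ (trans (cong w i≡j) (sym baseʳ))) meet)
        where
        meet : ∀ {s t} → s ≤ suc i → t ≤ suc d → cˡ s ≡ cʳ t → cˡ s ≡ cˡ 1
        meet s≤ t≤ q with common s≤ t≤ q
        ... | x , j≤x , x≤i , eq = trans eq (trans (cong w (≤-antisym x≤i (≤-trans (≤-reflexive i≡j) j≤x))) (sym baseˡ))

      j<i⇒⊥ : j < i → ⊥
      j<i⇒⊥ j<i = noOddPrism (theta⇒prism arc disjoint)
        where
        r = i ∸ suc j
        j+ : j + suc r ≡ i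
        j+ = trans (+-suc j r) (m+[n∸m]≡n j<i)
        S : Trail (suc r) (λ t → w (j + t))
        S = segment j (suc r) (≤-trans (≤-reflexive j+) i≤n) T
        middle : Arc (w j) (w i)
        middle = record
          { trail = S
          ; start = cong w (+-identityʳ j)
          ; end = cong w j+
          ; odd = even-suc (walk-even (Trail.walk S)
              (trans (cong (side ∘ w) (+-identityʳ j)) (trans (sym same) (cong (side ∘ w) (sym j+))))) }
        left : Arc (w j) (w i)
        left = reverse-arc (detour T j<i i≤n chordˡ same)
        chordʳ′ : Link (wˡ 0) (wˡ (n ∸ j))
        chordʳ′ = subst (Link (w n)) (sym (reversed-involutive w j≤n)) chordʳ
        same′ : side (wˡ (n ∸ j)) ≡ side (wˡ i̅)
        same′ = subst₂ (λ x y → side x ≡ side y)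
          (sym (reversed-involutive w j≤n)) (sym (reversed-involutive w i≤n)) (sym same)
        right₀ : Arc (wˡ (n ∸ j)) (wˡ i̅)
        right₀ = detour T̅ (∸-monoʳ-< j<i i≤n) (m∸n≤m n j) chordʳ′ same′
        right : Arc (w j) (w i)
        right = subst₂ Arc (reversed-involutive w j≤n) (reversed-involutive w i≤n) right₀

        -- From `w j` to `w i`: along the trail; back to `w 0` and over the left chord; over the
        -- right chord to `w n` and back.
        arc : Fin 3 → Arc (w j) (w i)
        arc zero = middle
        arc (suc zero) = left
        arc (suc (suc zero)) = right

        Range : Fin 3 → ℕ → Set
        Range zero x = j ≤ x × x ≤ i
        Range (suc zero) x = x ≤ j ⊎ x ≡ i
        Range (suc (suc zero)) x = i ≤ x ⊎ x ≡ j

        subst-on : ∀ {u u′ t t′} (p : u ≡ u′) (q : t ≡ t′) (A : Arc u t) {x} → OnArc (subst₂ Arc p q A) x → OnArc A x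
        subst-on refl refl A on = on

        range : ∀ a {x} → OnArc (arc a) x → ∃ λ y → y ≤ n × Range a y × w y ≡ x
        range zero (s , s≤ , q) = j + s , ≤-trans j+s≤i i≤n , (m≤m+n j s , j+s≤i) , q
          where j+s≤i = ≤-trans (+-monoʳ-≤ j s≤) (≤-reflexive j+)
        range (suc zero) on with detour-range T j<i i≤n chordˡ same (reverse-arc-on (detour T j<i i≤n chordˡ same) on)
        ... | y , inj₁ y≤j , q = y , ≤-trans y≤j j≤n , inj₁ y≤j , q
        ... | y , inj₂ refl , q = y , i≤n , inj₂ refl , q
        range (suc (suc zero)) on with detour-range T̅ (∸-monoʳ-< j<i i≤n) (m∸n≤m n j) chordʳ′ same′
          (subst-on (reversed-involutive w j≤n) (reversed-involutive w i≤n) right₀ on)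
        ... | y , inj₁ y≤ , q = n ∸ y , m∸n≤m n y , inj₁ (subst (_≤ n ∸ y) (m∸[m∸n]≡n i≤n) (∸-monoʳ-≤ n y≤)) , q
        ... | y , inj₂ refl , q = n ∸ y , m∸n≤m n y , inj₂ (m∸[m∸n]≡n j≤n) , q

        middle-left : ∀ {x} → Range zero x → Range (suc zero) x → x ≡ j ⊎ x ≡ i
        middle-left (j≤x , _) (inj₁ x≤j) = inj₁ (≤-antisym x≤j j≤x)
        middle-left _ (inj₂ q) = inj₂ q

        middle-right : ∀ {x} → Range zero x → Range (suc (suc zero)) x → x ≡ j ⊎ x ≡ i
        middle-right (_ , x≤i) (inj₁ i≤x) = inj₂ (≤-antisym x≤i i≤x)
        middle-right _ (inj₂ q) = inj₁ q

        left-right : ∀ {x} → Range (suc zero) x → Range (suc (suc zero)) x → x ≡ j ⊎ x ≡ i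
        left-right (inj₁ x≤j) (inj₁ i≤x) = ⊥-elim (<⇒≱ j<i (≤-trans i≤x x≤j))
        left-right _ (inj₂ q) = inj₁ q
        left-right (inj₂ q) _ = inj₂ q

        ends-only : ∀ a b → a ≢ b → ∀ {x} → Range a x → Range b x → x ≡ j ⊎ x ≡ i
        ends-only zero zero ne _ _ = ⊥-elim (ne refl)
        ends-only (suc zero) (suc zero) ne _ _ = ⊥-elim (ne refl)
        ends-only (suc (suc zero)) (suc (suc zero)) ne _ _ = ⊥-elim (ne refl)
        ends-only zero (suc zero) _ x y = middle-left x y
        ends-only (suc zero) zero _ x y = middle-left y x
        ends-only zero (suc (suc zero)) _ x y = middle-right x y
        ends-only (suc (suc zero)) zero _ x y = middle-right y x
        ends-only (suc zero) (suc (suc zero)) _ x y = left-right x y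
        ends-only (suc (suc zero)) (suc zero) _ x y = left-right y x

        disjoint : ∀ a b → a ≢ b → InternallyDisjoint (arc a) (arc b)
        disjoint a b a≢b on on′ with range a on | range b on′
        ... | y , y≤n , ra , q | y′ , y′≤n , rb , q′ with distinct y≤n y′≤n (trans q (sym q′))
        ...   | refl with ends-only a b a≢b ra rb
        ...     | inj₁ refl = inj₁ (sym q)
        ...     | inj₂ refl = inj₂ (sym q)

      by-order : Tri (i < j) (i ≡ j) (j < i) → ⊥
      by-order (tri< i<j _ _) = i<j⇒⊥ i<j
      by-order (tri≈ _ i≡j _) = i≡j⇒⊥ i≡j
      by-order (tri> _ _ j<i) = j<i⇒⊥ j<i

    anchored⇒⊥ : ∀ {n w} → 1 ≤ n → Trail n w → side (w 0) ≡ side (w n) → LeftAnchor n w → ¬ RightAnchor n w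
    anchored⇒⊥ (s≤s _) T p (inj₁ leaf) (inj₁ leaf′) = leaf-leaf T leaf leaf′ p
    anchored⇒⊥ _ T p (inj₁ leaf) (inj₂ chord) = leaf-chord T p leaf chord
    anchored⇒⊥ _ T p (inj₂ chord) (inj₂ chord′) = chord-chord T p chord chord′
    anchored⇒⊥ {n} {w} _ T p (inj₂ chord) (inj₁ leaf) =
      leaf-chord (reversed-trail T) (trans (sym p) (sym (cong side (reversed-last n w)))) leaf (reversed-chord {n} {w} chord)

    -- Matchings and alternating paths

    -- Two distinct parallel members of `Z` would be adjacent in `G`, and so form a path of length 1
    -- against consistency.
    Z-canonical : ∀ {z} → z ∈ Z → Canonical z
    Z-canonical {z} z∈Z z′ z′∈Z j j′ with z′ Data.Fin.≟ z
    ... | yes p = p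
    ... | no z′≢z = ⊥-elim (even⇒¬odd (consistent z′ z z′∈Z z∈Z 1 path (inj₁ (refl , refl))) (0 , refl))
      where
      adj : Adj G z′ z
      adj = share⇒adj j′ j z′≢z (inj₁ (inj₁ refl))
      vtx : Fin 2 → V G
      vtx zero = z′
      vtx (suc zero) = z
      inj : ∀ {s t} → vtx s ≡ vtx t → s ≡ t
      inj {zero} {zero} _ = refl
      inj {zero} {suc zero} p = ⊥-elim (z′≢z p)
      inj {suc zero} {zero} p = ⊥-elim (z′≢z (sym p))
      inj {suc zero} {suc zero} _ = refl
      edges : ∀ s t → Adj G (vtx s) (vtx t) ⇔ PathAdj s t
      edges zero zero = mk⇔ (λ a → ⊥-elim (adj⇒≢ {z′} {z′} a refl)) λ { (inj₁ ()) ; (inj₂ ()) }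
      edges zero (suc zero) = mk⇔ (λ _ → inj₁ refl) (λ _ → adj)
      edges (suc zero) zero = mk⇔ (λ _ → inj₂ refl) (λ _ → trans (Graph.adj-sym G z z′) adj)
      edges (suc zero) (suc zero) = mk⇔ (λ a → ⊥-elim (adj⇒≢ {z} {z} a refl)) λ { (inj₁ ()) ; (inj₂ ()) }
      path : Path G 1
      path = record { vtx = vtx ; inj = λ {s} {t} → inj {s} {t} ; edges = edges }

    -- Either a member of `Z` is parallel or equal to `e` and is canonical, or `e` itself is
    -- canonical for want of one. A double negation suffices, since the final goal is a
    -- contradiction.
    joins⇒link : ∀ {e u v} → Joins e u v → ¬ ¬ Link u v
    joins⇒link {e} {u} {v} j k = ¬¬-excluded-middle {A = ∃ λ z → z ∈ Z × Joins z u v} λ where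
        (yes (z , z∈Z , j′)) → k (link z j′ (Z-canonical z∈Z))
        (no none) → k (link e j λ z z∈Z p q → ⊥-elim (none (z , z∈Z , transport q (joins-unique refl p j))))
      where
      transport : ∀ {z x y} → Joins z x y → (x ≡ u × y ≡ v) ⊎ (x ≡ v × y ≡ u) → Joins z u v
      transport q (inj₁ (refl , refl)) = q
      transport q (inj₂ (refl , refl)) = joins-sym q

    zleaf-link : ∀ {v} (leaf : ZLeaf v) → Link v (ZLeaf.u leaf)
    zleaf-link leaf = link _ (ZLeaf.joins leaf) (Z-canonical (ZLeaf.z∈Z leaf))

    record _∈ᵐ_ (e : V G) (S : V G → Bool) : Set where
      constructor chosen
      field holds : S e ≡ true

    record Matching (S : V G → Bool) : Set where
      field
        canonical : ∀ {e} → e ∈ᵐ S → Canonical e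
        disjoint  : ∀ {e f x u v} → e ∈ᵐ S → f ∈ᵐ S → Joins e x u → Joins f x v → e ≡ f

    Covers : (V G → Bool) → Fin m → Set
    Covers S x = ∃ λ e → ∃ λ u → e ∈ᵐ S × Joins e x u

    insert remove : V G → (V G → Bool) → V G → Bool
    insert e S f = if does (f Data.Fin.≟ e) then true else S f
    remove e S f = if does (f Data.Fin.≟ e) then false else S f

    insert-self : ∀ e S → e ∈ᵐ insert e S
    insert-self e S = chosen go
      where
      go : insert e S e ≡ true
      go with e Data.Fin.≟ e
      ... | yes _ = refl
      ... | no ne = ⊥-elim (ne refl)

    insert-mono : ∀ e {S f} → f ∈ᵐ S → f ∈ᵐ insert e S
    insert-mono e {S} {f} (chosen p) = chosen go
      where
      go : insert e S f ≡ true
      go with f Data.Fin.≟ e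
      ... | yes _ = refl
      ... | no _ = p

    insert⁻ : ∀ e {S f} → f ∈ᵐ insert e S → f ≡ e ⊎ f ∈ᵐ S
    insert⁻ e {f = f} (chosen p) with f Data.Fin.≟ e
    ... | yes q = inj₁ q
    ... | no _ = inj₂ (chosen p)

    remove⁺ : ∀ e {S f} → f ≢ e → f ∈ᵐ S → f ∈ᵐ remove e S
    remove⁺ e {S} {f} ne (chosen p) = chosen go
      where
      go : remove e S f ≡ true
      go with f Data.Fin.≟ e
      ... | yes q = ⊥-elim (ne q)
      ... | no _ = p

    remove⁻ : ∀ e {S f} → f ∈ᵐ remove e S → f ≢ e × f ∈ᵐ S
    remove⁻ e {f = f} (chosen p) with f Data.Fin.≟ e
    ... | no ne = ne , chosen p
    remove⁻ e (chosen ()) | yes _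

    insert-covers : ∀ e {S x} → Covers S x → Covers (insert e S) x
    insert-covers e (f , u , f∈S , j) = f , u , insert-mono e f∈S , j

    insert-covers⁻ : ∀ {e u v S x} → Joins e u v → Covers (insert e S) x → x ≡ u ⊎ x ≡ v ⊎ Covers S x
    insert-covers⁻ {e} j (f , y , f∈ , j′) with insert⁻ e f∈
    ... | inj₂ f∈S = inj₂ (inj₂ (f , y , f∈S , j′))
    ... | inj₁ f≡e with joins-unique f≡e j′ j
    ...   | inj₁ (p , _) = inj₁ p
    ...   | inj₂ (p , _) = inj₂ (inj₁ p)

    remove-covers : ∀ {e u v S x} → Joins e u v → Covers S x → x ≡ u ⊎ x ≡ v ⊎ Covers (remove e S) x
    remove-covers {e} j (f , y , f∈S , j′) with f Data.Fin.≟ e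
    ... | no f≢e = inj₂ (inj₂ (f , y , remove⁺ e f≢e f∈S , j′))
    ... | yes f≡e with joins-unique f≡e j′ j
    ...   | inj₁ (p , _) = inj₁ p
    ...   | inj₂ (p , _) = inj₂ (inj₁ p)

    remove-covers⁻ : ∀ e {S x} → Covers (remove e S) x → Covers S x
    remove-covers⁻ e (f , y , f∈ , j) = f , y , proj₂ (remove⁻ e f∈) , j

    remove-uncovers : ∀ {e u v S} → Matching S → e ∈ᵐ S → Joins e u v → ¬ Covers (remove e S) u
    remove-uncovers {e} M e∈S j (f , y , f∈ , j′) with remove⁻ e f∈
    ... | f≢e , f∈S = f≢e (Matching.disjoint M f∈S e∈S j′ j)

    insert-matching : ∀ {S u v} → Matching S → (l : Link u v) → ¬ Covers S u → ¬ Covers S v →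
      Matching (insert (Link.edge l) S)
    insert-matching {S} {u} {v} M (link e j can) ¬u ¬v = record { canonical = canonical ; disjoint = disjoint }
      where
      canonical : ∀ {f} → f ∈ᵐ insert e S → Canonical f
      canonical f∈ with insert⁻ e f∈
      ... | inj₁ refl = can
      ... | inj₂ f∈S = Matching.canonical M f∈S
      fresh : ∀ {f g x y z} → f ≡ e → g ∈ᵐ S → Joins f x y → Joins g x z → ⊥
      fresh f≡e g∈S p q with joins-unique f≡e p j
      ... | inj₁ (refl , _) = ¬u (_ , _ , g∈S , q)
      ... | inj₂ (refl , _) = ¬v (_ , _ , g∈S , q)
      disjoint : ∀ {f g x y z} → f ∈ᵐ insert e S → g ∈ᵐ insert e S → Joins f x y → Joins g x z → f ≡ g
      disjoint f∈ g∈ p q with insert⁻ e f∈ | insert⁻ e g∈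
      ... | inj₁ a | inj₁ b = trans a (sym b)
      ... | inj₁ a | inj₂ b = ⊥-elim (fresh a b p q)
      ... | inj₂ a | inj₁ b = ⊥-elim (fresh b a q p)
      ... | inj₂ a | inj₂ b = Matching.disjoint M a b p q

    remove-matching : ∀ {S} e → Matching S → Matching (remove e S)
    remove-matching e M = record
      { canonical = λ f∈ → Matching.canonical M (proj₂ (remove⁻ e f∈))
      ; disjoint = λ f∈ g∈ → Matching.disjoint M (proj₂ (remove⁻ e f∈)) (proj₂ (remove⁻ e g∈)) }

    -- `here` leaves `n` free: the trail may run on beyond `a` in any manner. This is what allows
    -- growing in a second direction from `a` while the part grown first stays in the same trail.
    data Alternating (S : V G → Bool) (a : Fin m) : ℕ → (ℕ → Fin m) → Set where
      here  : ∀ {n w} → w 0 ≡ a → Alternating S a n w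
      there : ∀ {n w e} → e ∈ᵐ S → Joins e (w 0) (w 1) → Alternating S a n (w ∘ (2 +_)) → Alternating S a (2 + n) w

    alternating-map : ∀ {S S′ a n w} → (∀ {f i x} → i ≤ n → f ∈ᵐ S → Joins f (w i) x → f ∈ᵐ S′) →
      Alternating S a n w → Alternating S′ a n w
    alternating-map h (here p) = here p
    alternating-map h (there e∈S j A) = there (h z≤n e∈S j) j (alternating-map (λ i≤n → h (s≤s (s≤s i≤n))) A)

    -- Shifting the matching along the path one step at a time keeps it a matching throughout.
    augment : ∀ {S a n w b} → Matching S → Trail n w → Alternating S a n w → ¬ Covers S a → ¬ Covers S b →
      Link (w 0) b → (∀ {i} → i ≤ n → w i ≢ b) →
      ∃ λ S′ → Matching S′ × Covers S′ a × Covers S′ b × (∀ {x} → Covers S x → Covers S′ x)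
    augment {S} {b = b} M T (here refl) ¬a ¬b l fresh =
      insert e S , insert-matching M l ¬a ¬b , (e , _ , insert-self e S , Link.joins l)
      , (e , _ , insert-self e S , joins-sym (Link.joins l)) , insert-covers e
      where e = Link.edge l
    augment {S} {a} {suc (suc n)} {w} {b} M T (there {e = e} e∈S j A) ¬a ¬b l fresh = shift
      where
      open Trail T using (walk; distinct)
      f = Link.edge l
      S₁ = remove e S
      S₂ = insert f S₁
      ¬a₁ : ¬ Covers S₁ a
      ¬a₁ c = ¬a (remove-covers⁻ e c)
      M₂ : Matching S₂
      M₂ = insert-matching (remove-matching e M) l (remove-uncovers M e∈S j) (λ c → ¬b (remove-covers⁻ e c))
      a-on : ∀ {n w} → Alternating S a n w → ∃ λ i → i ≤ n × w i ≡ a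
      a-on (here p) = 0 , z≤n , p
      a-on (there _ _ A) with a-on A
      ... | i , i≤n , p = suc (suc i) , s≤s (s≤s i≤n) , p
      ¬a₂ : ¬ Covers S₂ a
      ¬a₂ c with insert-covers⁻ (Link.joins l) c
      ... | inj₂ (inj₂ c′) = ¬a₁ c′
      ... | inj₁ refl = ¬a (e , _ , e∈S , j)
      ... | inj₂ (inj₁ a≡b) with a-on (there {e = e} e∈S j A)
      ...   | i , i≤n , p = fresh i≤n (trans p a≡b)
      ¬w₁ : ¬ Covers S₂ (w 1)
      ¬w₁ c with insert-covers⁻ (Link.joins l) c
      ... | inj₁ p = 1+n≢0 (distinct (s≤s z≤n) z≤n p)
      ... | inj₂ (inj₁ p) = fresh (s≤s z≤n) p
      ... | inj₂ (inj₂ c′) = remove-uncovers M e∈S (joins-sym j) c′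
      kept : ∀ {g i x} → i ≤ n → g ∈ᵐ S → Joins g (w (2 + i)) x → g ∈ᵐ S₂
      kept {g} {i} i≤n g∈S j′ = insert-mono f (remove⁺ e g≢e g∈S)
        where
        g≢e : g ≢ e
        g≢e p with joins-unique p j′ j
        ... | inj₁ (q , _) = 1+n≢0 (distinct (s≤s (s≤s i≤n)) z≤n q)
        ... | inj₂ (q , _) = 1+n≢0 (suc-injective (distinct (s≤s (s≤s i≤n)) (s≤s z≤n) q))
      fresh₁ : ∀ {i} → i ≤ n → w (2 + i) ≢ w 1
      fresh₁ i≤n p = 1+n≢0 (suc-injective (distinct (s≤s (s≤s i≤n)) (s≤s z≤n) p))
      shift : ∃ λ S′ → Matching S′ × Covers S′ a × Covers S′ b × (∀ {x} → Covers S x → Covers S′ x)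
      -- After `e` is exchanged for `f`, the uncovered vertex is `w 1`, which takes the place of `b`
      -- for the trail starting at `w 2`.
      shift with augment M₂ (segment 2 n ≤-refl T) (alternating-map kept A) ¬a₂ ¬w₁
        (link-sym (walk 1 (s≤s (s≤s z≤n)))) fresh₁
      ... | S′ , M′ , ca , cw₁ , mono = S′ , M′ , ca , mono (f , _ , insert-self f S₁ , joins-sym (Link.joins l)) , mono′
        where
        mono′ : ∀ {x} → Covers S x → Covers S′ x
        mono′ c with remove-covers j c
        ... | inj₁ refl = mono (f , _ , insert-self f S₁ , Link.joins l)
        ... | inj₂ (inj₁ refl) = cw₁
        ... | inj₂ (inj₂ c′) = mono (insert-covers f c′)

    -- Apart from Z-leaves, the vertices of H whose incident edges form a maximal clique of G.
    data Star (v : Fin m) : Set where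
      branching : ∀ {u u′} → u ≢ u′ → Link v u → Link v u′ → Star v
      zleaf     : ZLeaf v → Star v
      isolated  : ∀ {u} → Link v u → (∀ {e x} → Joins e v x → x ≡ u) → (∀ {e x} → Joins e u x → x ≡ v) → Star v

    another : ∀ {v u u′} → u ≢ u′ → Link v u → Link v u′ → ∀ b → ∃ λ y → y ≢ b × Link v y
    another {u = u} {u′} u≢u′ l l′ b with u Data.Fin.≟ b
    ... | yes refl = u′ , ≢-sym u≢u′ , l′
    ... | no u≢b = u , u≢b , l

    -- Only `Star` vertices must stay covered, so a mate that is not one may be given up.
    Improves : (V G → Bool) → Fin m → Set
    Improves S a = ∃ λ S′ → Matching S′ × Covers S′ a × (∀ {x} → Star x → Covers S x → Covers S′ x)

    cons : Fin m → (ℕ → Fin m) → ℕ → Fin m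
    cons y w zero = y
    cons y w (suc i) = w i

    cons-trail : ∀ {n w y} → Trail n w → Link y (w 0) → (∀ {i} → i ≤ n → w i ≢ y) → Trail (suc n) (cons y w)
    cons-trail {n} {w} {y} T l fresh = record { walk = walk ; distinct = distinct }
      where
      walk : Walk (suc n) (cons y w)
      walk zero _ = l
      walk (suc i) (s≤s i<n) = Trail.walk T i i<n
      distinct : ∀ {i j} → i ≤ suc n → j ≤ suc n → cons y w i ≡ cons y w j → i ≡ j
      distinct {zero} {zero} _ _ _ = refl
      distinct {zero} {suc j} _ (s≤s j≤n) p = ⊥-elim (fresh j≤n (sym p))
      distinct {suc i} {zero} (s≤s i≤n) _ p = ⊥-elim (fresh i≤n p)
      distinct {suc i} {suc j} (s≤s i≤n) (s≤s j≤n) p = cong suc (Trail.distinct T i≤n j≤n p)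

    trail-short : ∀ {n w} → Trail n w → n < m
    trail-short T = injective⇒≤ λ {s} {t} p →
      toℕ-injective (Trail.distinct T (≤-pred (toℕ<n s)) (≤-pred (toℕ<n t)) p)

    -- Growing alternating paths from an uncovered vertex

    module _ {S a} (M : Matching S) (uncovered : ¬ Covers S a) (¬improves : ¬ Improves S a) where

      -- By closed, the mate of a vertex off the path is off the path as well.
      record Exploration (n : ℕ) (w : ℕ → Fin m) : Set where
        field
          trail       : Trail n w
          alternating : Alternating S a n w
          head        : side (w 0) ≡ side a
          closed      : ∀ {i e x} → i ≤ n → side (w i) ≡ side a → e ∈ᵐ S → Joins e (w i) x → ∃ λ j → j ≤ n × w j ≡ x

      -- R records what is known about the far end of the path, which never changes.
      explore : (R : ℕ → (ℕ → Fin m) → Set) → (∀ {n w y} → R n w → R (suc n) (cons y w)) →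
        (∀ {n w} → 1 ≤ n → Exploration n w → R n w → ¬ LeftAnchor n w) →
        ∀ fuel {n w b} → m ≤ fuel + n → Exploration n w → R n w → Link (w 0) b → (∀ {i} → i ≤ n → w i ≢ b) → ⊥
      -- Without fuel the trail would have more than `m` distinct vertices.
      explore R R-cons stuck zero m≤n X _ _ _ = <⇒≱ (trail-short (Exploration.trail X)) m≤n
      explore R R-cons stuck (suc fuel) {n} {w} {b} m≤ X r l fresh = ¬¬-excluded-middle λ where
          (no ¬b) → add-b ¬b
          (yes (e , α , e∈S , j)) → through-mate e∈S j
        where
        open Exploration X
        add-b : ¬ ¬ Covers S b
        add-b ¬b with augment M trail alternating uncovered ¬b l fresh
        ... | S′ , M′ , ca , _ , mono = ¬improves (S′ , M′ , ca , λ _ → mono)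

        module _ {e α} (e∈S : e ∈ᵐ S) (j : Joins e b α) where
          α-side : side α ≡ side a
          α-side = sym (trans (sym head) (≢-≢⇒≡ (link-side l) (joins-side j)))

          -- If `α` were on the path, `closed` would put its mate `b` there too.
          fresh-α : ∀ {i} → i ≤ n → w i ≢ α
          fresh-α i≤n refl with closed i≤n α-side e∈S (joins-sym j)
          ... | _ , i′≤n , q = fresh i′≤n q

          w⁺ : ℕ → Fin m
          w⁺ = cons α (cons b w)

          X⁺ : Exploration (2 + n) w⁺
          X⁺ = record
            { trail = cons-trail (cons-trail trail (link-sym l) fresh)
                (link e (joins-sym j) (Matching.canonical M e∈S)) fresh′
            ; alternating = there e∈S (joins-sym j) alternating
            ; head = α-side
            ; closed = closed⁺ }
            where
            fresh′ : ∀ {i} → i ≤ suc n → cons b w i ≢ α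
            fresh′ {zero} _ p = joins-irrefl j p
            fresh′ {suc i} (s≤s i≤n) p = fresh-α i≤n p
            closed⁺ : ∀ {i f x} → i ≤ 2 + n → side (w⁺ i) ≡ side a → f ∈ᵐ S → Joins f (w⁺ i) x → ∃ λ k → k ≤ 2 + n × w⁺ k ≡ x
            closed⁺ {zero} _ _ f∈S j′ with joins-unique (Matching.disjoint M f∈S e∈S j′ (joins-sym j)) j′ (joins-sym j)
            ... | inj₁ (_ , q) = 1 , s≤s z≤n , sym q
            ... | inj₂ (q , _) = ⊥-elim (joins-irrefl j (sym q))
            closed⁺ {suc zero} _ p _ _ = ⊥-elim (link-side l (trans head (sym p)))
            closed⁺ {suc (suc i)} (s≤s (s≤s i≤n)) p f∈S j′ with closed i≤n p f∈S j′
            ... | k , k≤n , q = 2 + k , s≤s (s≤s k≤n) , q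

          r⁺ : R (2 + n) w⁺
          r⁺ = R-cons (R-cons r)

          -- Giving up `e` uncovers `b` and so makes the path augmentable; the only vertex that may
          -- lose its cover is `α`.
          drop-α : ¬ ¬ Star α
          drop-α ¬star with augment (remove-matching e M) trail (alternating-map kept alternating)
              (λ c → uncovered (remove-covers⁻ e c)) (remove-uncovers M e∈S j) l fresh
            where
            kept : ∀ {f i x} → i ≤ n → f ∈ᵐ S → Joins f (w i) x → f ∈ᵐ remove e S
            kept {f} i≤n f∈S j′ = remove⁺ e f≢e f∈S
              where
              f≢e : f ≢ e
              f≢e p with joins-unique p j′ j
              ... | inj₁ (q , _) = fresh i≤n q
              ... | inj₂ (q , _) = fresh-α i≤n q
          ... | S′ , M′ , ca , cb , mono = ¬improves (S′ , M′ , ca , mono′)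
            where
            mono′ : ∀ {x} → Star x → Covers S x → Covers S′ x
            mono′ s c with remove-covers j c
            ... | inj₁ refl = cb
            ... | inj₂ (inj₁ refl) = ⊥-elim (¬star s)
            ... | inj₂ (inj₂ c′) = mono c′

          extend : ¬ Star α
          extend (zleaf leaf) = stuck (s≤s z≤n) X⁺ r⁺ (inj₁ leaf)
          -- The only neighbour of `b` would be `α`, yet `w 0` is one too and differs from `α`.
          extend (isolated _ only only′) with only (joins-sym j)
          ... | refl = fresh-α z≤n (only′ (joins-sym (Link.joins l)))
          extend (branching u≢u′ p p′) with another u≢u′ p p′ b
          -- If `y` is on the path, the link to it is a chord anchoring the path: index 0 would be a
          -- loop and index 1 is `b`. Otherwise the path grows.
          ... | y , y≢b , q = ¬¬-excluded-middle {A = ∃ λ i → i ≤ 2 + n × w⁺ i ≡ y} λ where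
              (yes (zero , _ , eq)) → link-irrefl q eq
              (yes (suc zero , _ , eq)) → y≢b (sym eq)
              (yes (suc (suc i) , i≤ , refl)) → stuck (s≤s z≤n) X⁺ r⁺ (inj₂ (2 + i , s≤s (s≤s z≤n) , i≤ , q))
              (no off) → explore R R-cons stuck fuel m≤′ X⁺ r⁺ q (λ i≤ eq → off (_ , i≤ , eq))
            where
            m≤′ : m ≤ fuel + (2 + n)
            m≤′ = ≤-trans m≤ (≤-trans (≤-reflexive (sym (+-suc fuel n))) (+-monoʳ-≤ fuel (n≤1+n (suc n))))

          through-mate : ⊥
          through-mate = drop-α extend

      start : Exploration 0 (λ _ → a)
      start = record
        { trail = record { walk = λ _ () ; distinct = λ { z≤n z≤n _ → refl } }
        ; alternating = here refl
        ; head = refl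
        ; closed = λ _ _ e∈S j → ⊥-elim (uncovered (_ , _ , e∈S , j)) }

      m≤m+0 : m ≤ m + 0
      m≤m+0 = m≤m+n m 0

      start-fresh : ∀ {b} → Link a b → ∀ {i} → i ≤ 0 → a ≢ b
      start-fresh l _ = link-irrefl l

      -- With `a` in front, alternation starts afresh by `here`. The property `closed` survives the
      -- reversal and keeps later mates off the old part.
      turn : ∀ {n w} → Exploration n w → w n ≡ a → Exploration n (reversed n w)
      turn {n} {w} X p = record
        { trail = reversed-trail trail
        ; alternating = here p
        ; head = cong side p
        ; closed = λ {i} i≤n q e∈S j → reindex (closed (m∸n≤m n i) q e∈S j) }
        where
        open Exploration X
        reindex : ∀ {x} → (∃ λ k → k ≤ n × w k ≡ x) → ∃ λ k → k ≤ n × reversed n w k ≡ x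
        reindex (k , k≤n , q) = n ∸ k , m∸n≤m n k , trans (reversed-involutive w k≤n) q

      -- At an isolated edge the other end is uncovered as well, so the edge can be added. A Z-leaf
      -- is already an anchor, so growing once gives a trail anchored at both ends. A branching
      -- vertex needs two rounds: the first anchors one end, then the path is turned and continued
      -- through another neighbour of `a`.
      not-star : ¬ Star a
      not-star (isolated {u} l only only′) with augment M (Exploration.trail start) (here refl) uncovered ¬u l (start-fresh l)
        where
        ¬u : ¬ Covers S u
        ¬u (e , x , e∈S , j) with only′ j
        ... | refl = uncovered (e , u , e∈S , joins-sym j)
      ... | S′ , M′ , ca , _ , mono = ¬improves (S′ , M′ , ca , λ _ → mono)
      not-star (zleaf leaf) = explore (λ n w → w n ≡ a) (λ p → p) stuck m m≤m+0 start refl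
          (zleaf-link leaf) (start-fresh (zleaf-link leaf))
        where
        stuck : ∀ {n w} → 1 ≤ n → Exploration n w → w n ≡ a → ¬ LeftAnchor n w
        stuck 1≤n X p anchor = anchored⇒⊥ 1≤n (Exploration.trail X)
          (trans (Exploration.head X) (cong side (sym p))) anchor (inj₁ (subst ZLeaf (sym p) leaf))
      not-star (branching {u} u≢u′ l l′) = explore (λ n w → w n ≡ a) (λ p → p) second m m≤m+0 start refl
          l (start-fresh l)
        where
        Right : ℕ → (ℕ → Fin m) → Set
        Right n w = side (w n) ≡ side a × RightAnchor n w
        Right-cons : ∀ {n w y} → Right n w → Right (suc n) (cons y w)
        Right-cons (p , inj₁ leaf) = p , inj₁ leaf
        Right-cons (p , inj₂ (j , d , 2≤d , q , chord)) = p , inj₂ (suc j , d , 2≤d , cong suc q , chord)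
        stuck : ∀ {n w} → 1 ≤ n → Exploration n w → Right n w → ¬ LeftAnchor n w
        stuck 1≤n X (p , right) left = anchored⇒⊥ 1≤n (Exploration.trail X) (trans (Exploration.head X) (sym p)) left right
        second : ∀ {n w} → 1 ≤ n → Exploration n w → w n ≡ a → ¬ LeftAnchor n w
        -- The new neighbour must differ from the one through which the path already leaves `a`. If
        -- it is on the path, it gives a chord at once and no second round is needed.
        second {n} {w} 1≤n X p left with another u≢u′ l l′ (reversed n w 1)
        ... | y , y≢ , q = ¬¬-excluded-middle {A = ∃ λ i → i ≤ n × reversed n w i ≡ y} λ where
            (yes (zero , _ , eq)) → link-irrefl q (trans (sym p) eq)
            (yes (suc zero , _ , eq)) → y≢ (sym eq)
            (yes (suc (suc i) , i≤n , refl)) → stuck 1≤n (turn X p) right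
              (inj₂ (2 + i , s≤s (s≤s z≤n) , i≤n , subst (λ x → Link x _) (sym p) q))
            (no off) → explore Right Right-cons stuck m (m≤m+n m n) (turn X p) right
              (subst (λ x → Link x y) (sym p) q) (λ i≤n eq → off (_ , i≤n , eq))
          where
          right : Right n (reversed n w)
          right = trans (cong side (reversed-last n w)) (Exploration.head X) , reversed-anchor {n} {w} left

    -- Covering every `Star` vertex

    improve : ∀ {S a} → Matching S → Star a → ¬ Covers S a → ¬ ¬ Improves S a
    improve M s ¬a ¬improves = not-star M ¬a ¬improves s

    cover-all : ∀ xs → ¬ ¬ ∃ λ S → Matching S × (∀ {x} → x List.∈ xs → Star x → Covers S x)
    cover-all [] k = k ((λ _ → false) , record { canonical = λ { (chosen ()) } ; disjoint = λ { (chosen ()) } } , λ ())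
    cover-all (y ∷ xs) k = cover-all xs λ (S , M , covers) → ¬¬-excluded-middle λ where
      (yes c) → k (S , M , λ { (here refl) _ → c ; (there x∈xs) s → covers x∈xs s })
      (no ¬c) → ¬¬-excluded-middle λ where
        (no ¬s) → k (S , M , λ { (here refl) s → ⊥-elim (¬s s) ; (there x∈xs) s → covers x∈xs s })
        (yes s) → improve M s ¬c λ (S′ , M′ , cy , mono) →
          k (S′ , M′ , λ { (here refl) _ → cy ; (there x∈xs) s′ → mono s′ (covers x∈xs s′) })

    -- Strong stable sets from matchings

    Touches : Fin m → V G → Set
    Touches v e = ∃ λ u → Joins e v u

    touches? : ∀ v e → Dec (Touches v e)
    touches? v e = map′
      (λ { (inj₁ p) → _ , inj₁ (cong (_, proj₂ (ends e)) p) ; (inj₂ p) → _ , inj₂ (cong (proj₁ (ends e) ,_) p) })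
      (λ { (_ , inj₁ p) → inj₁ (cong proj₁ p) ; (_ , inj₂ p) → inj₂ (cong proj₂ p) })
      ((proj₁ (ends e) Data.Fin.≟ v) ⊎-dec (proj₂ (ends e) Data.Fin.≟ v))

    adj⇒touches : ∀ {e f u v} → Joins e u v → Adj G e f → Touches u f ⊎ Touches v f
    adj⇒touches {f = f} j a with adj⇒share j (joins-ends f) a
    ... | inj₁ (inj₁ refl) = inj₁ (_ , inj₁ refl)
    ... | inj₁ (inj₂ refl) = inj₁ (_ , inj₂ refl)
    ... | inj₂ (inj₁ refl) = inj₂ (_ , inj₁ refl)
    ... | inj₂ (inj₂ refl) = inj₂ (_ , inj₂ refl)

    adj⇒meet : ∀ {e f} → Adj G e f → ∃ λ v → Touches v e × Touches v f
    adj⇒meet {e} a with adj⇒touches (joins-ends e) a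
    ... | inj₁ t = _ , (_ , joins-ends e) , t
    ... | inj₂ t = _ , (_ , joins-sym (joins-ends e)) , t

    toSubset : (V G → Bool) → VSet G
    toSubset S = tabulate S

    ∈-toSubset⁺ : ∀ {S e} → S e ≡ true → e ∈ toSubset S
    ∈-toSubset⁺ {S} {e} p = lookup⇒[]= e (tabulate S) (trans (lookup∘tabulate S e) p)

    ∈-toSubset⁻ : ∀ {S e} → e ∈ toSubset S → S e ≡ true
    ∈-toSubset⁻ {S} {e} p = trans (sym (lookup∘tabulate S e)) ([]=⇒lookup p)

    δ : Fin m → VSet G
    δ v = toSubset (λ e → does (touches? v e))

    ∈-δ⁺ : ∀ {v e} → Touches v e → e ∈ δ v
    ∈-δ⁺ {v} {e} t = ∈-toSubset⁺ (dec-true (touches? v e) t)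

    ∈-δ⁻ : ∀ {v e} → e ∈ δ v → Touches v e
    ∈-δ⁻ {v} {e} p = decidable-stable (touches? v e) λ ¬t →
      not-¬ refl (trans (sym (dec-false (touches? v e) ¬t)) (∈-toSubset⁻ {λ f → does (touches? v f)} p))

    δ-clique : ∀ {v e} → Touches v e → Clique G (δ v)
    δ-clique {v} {e} t = (e , ∈-δ⁺ t) , λ f g f∈ g∈ f≢g →
      share⇒adj (proj₂ (∈-δ⁻ {v} f∈)) (proj₂ (∈-δ⁻ {v} g∈)) f≢g (inj₁ (inj₁ refl))

    -- Suppose both ends of `z` have further neighbours. Edges to these from the two ends are
    -- adjacent to `z`, hence to each other as `z` is simplicial, and this closes a triangle in the
    -- bipartite `H`.
    Z-pendant : ∀ {z x y} → z ∈ Z → Joins z x y → ¬ ¬ (ZLeaf x ⊎ ZLeaf y)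
    Z-pendant {z} {x} {y} z∈Z j k =
      leaf-or-other (λ leaf → k (inj₁ leaf)) j λ e x′ je x′≢y →
      leaf-or-other (λ leaf → k (inj₂ leaf)) (joins-sym j) λ f y′ jf y′≢x →
        not-simplicial je x′≢y jf y′≢x
      where
      leaf-or-other : ∀ {u v} → ¬ ZLeaf u → Joins z u v → ¬ (∀ e x → Joins e u x → x ≢ v → ⊥)
      leaf-or-other {u} {v} ¬leaf j none = ¬leaf record
        { z∈Z = z∈Z ; joins = j ; only = λ {e} {x} je → decidable-stable (x Data.Fin.≟ v) (none e x je) }
      touching : ∀ {e u v x} → Joins z u v → Joins e u x → x ≢ v → Adj G z e
      touching j je x≢v = share⇒adj j je (λ p → z≢e (joins-unique p j je)) (inj₁ (inj₁ refl))
        where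
        z≢e : ¬ _
        z≢e (inj₁ (_ , q)) = x≢v (sym q)
        z≢e (inj₂ (q , _)) = joins-irrefl je q
      not-simplicial : ∀ {e f x′ y′} → Joins e x x′ → x′ ≢ y → Joins f y y′ → y′ ≢ x → ⊥
      not-simplicial {e} {f} je x′≢y jf y′≢x
        with adj⇒share je jf (proj₁ (safe z z∈Z) e f (touching j je x′≢y) (touching (joins-sym j) jf y′≢x) e≢f)
        where
        e≢f : e ≢ f
        e≢f p with joins-unique p je jf
        ... | inj₁ (q , _) = joins-irrefl j q
        ... | inj₂ (q , _) = y′≢x (sym q)
      ... | inj₁ (inj₁ p) = joins-irrefl j p
      ... | inj₁ (inj₂ p) = y′≢x (sym p)
      ... | inj₂ (inj₁ p) = x′≢y p
      ... | inj₂ (inj₂ refl) = joins-side j (≢-≢⇒≡ (joins-side je) (≢-sym (joins-side jf)))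

    module _ {S} (M : Matching S) (covers : ∀ {x} → Star x → Covers S x) where

      stable : Stable G (toSubset S)
      stable e f e∈ f∈ a with adj⇒meet {e} {f} a
      ... | _ , (_ , j) , (_ , j′) =
        adj⇒≢ {e} {f} a (Matching.disjoint M (chosen (∈-toSubset⁻ e∈)) (chosen (∈-toSubset⁻ f∈)) j j′)

      contains-Z : Z ⊆ toSubset S
      contains-Z {z} z∈Z = ∈-toSubset⁺ (decidable-stable (S z Data.Bool.≟ true) λ z∉S →
        Z-pendant z∈Z (joins-ends z) λ where
          (inj₁ leaf) → z∉S (leaf-chosen leaf (joins-ends z))
          (inj₂ leaf) → z∉S (leaf-chosen leaf (joins-sym (joins-ends z))))
        where
        -- The edge covering the leaf is parallel or equal to `z`, and canonicity of the matching
        -- makes it `z`.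
        leaf-chosen : ∀ {x y} → ZLeaf x → Joins z x y → S z ≡ true
        leaf-chosen leaf j with covers (zleaf leaf)
        ... | e , u , e∈S , je with trans (ZLeaf.only leaf je) (sym (ZLeaf.only leaf j))
        ...   | refl with Matching.canonical M e∈S z z∈Z je j
        ...     | refl = _∈ᵐ_.holds e∈S

      module _ {K} (K-max : MaximalClique G K) (missed : ¬ ∃ λ e → e ∈ toSubset S × e ∈ K) where

        private
          pairwise = proj₂ (proj₁ K-max)
          maximal = proj₂ K-max

        -- If all of `K` passes through `v`, maximality puts every edge at `v` into `K`, so `v`
        -- cannot be covered and is no `Star`. Hence `u` is its only neighbour, all of `K` passes
        -- through `u` too, and by maximality again `v` is the only neighbour of `u`. But then `v`
        -- is an isolated `Star`.
        not-through : ∀ {e v u} → e ∈ K → Joins e v u → ¬ (∀ {f} → f ∈ K → Touches v f)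
        not-through {e} {v} {u} e∈K j through =
          joins⇒link j λ l → ¬star (isolated l only only′)
          where
          ¬star : ¬ Star v
          ¬star s with covers s
          ... | f , x , chosen f∈S , jf = missed (f , ∈-toSubset⁺ f∈S ,
            maximal (δ v) (δ-clique (u , j)) (λ g∈K → ∈-δ⁺ (through g∈K)) (∈-δ⁺ (x , jf)))
          only : ∀ {f x} → Joins f v x → x ≡ u
          only {f} {x} jf = decidable-stable (x Data.Fin.≟ u) λ x≢u →
            joins⇒link jf λ l → joins⇒link j λ l′ → ¬star (branching x≢u l l′)
          through-u : ∀ {f} → f ∈ K → Touches u f
          through-u f∈K = let x , jf = through f∈K in v , joins-sym (subst (Joins _ v) (only jf) jf)
          only′ : ∀ {f x} → Joins f u x → x ≡ v
          only′ {f} {x} jf = opposite (joins-unique refl jf (proj₂ (through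
            (maximal (δ u) (δ-clique (v , joins-sym j)) (λ g∈K → ∈-δ⁺ (through-u g∈K)) (∈-δ⁺ (x , jf))))))
            where
            opposite : ∀ {y} → (u ≡ v × x ≡ y) ⊎ (u ≡ y × x ≡ v) → x ≡ v
            opposite (inj₁ (p , _)) = ⊥-elim (joins-irrefl j (sym p))
            opposite (inj₂ (_ , p)) = p

        avoiding : ∀ {e v u} → e ∈ K → Joins e v u → ¬ ¬ ∃ λ f → f ∈ K × ¬ Touches v f
        avoiding {v = v} e∈K j none =
          not-through e∈K j λ {f} f∈K → decidable-stable (touches? v f) λ ¬t → none (f , f∈K , ¬t)

        -- Two members avoiding one end each of a third member cannot share an end, by bipartiteness.
        impossible : ⊥
        impossible with proj₁ (proj₁ K-max)
        ... | e , e∈K = avoiding e∈K (joins-ends e) λ (f , f∈K , ¬f) →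
          avoiding e∈K (joins-sym (joins-ends e)) λ (g , g∈K , ¬g) → clash f∈K ¬f g∈K ¬g
          where
          x = proj₁ (ends e)
          y = proj₂ (ends e)
          j : Joins e x y
          j = joins-ends e
          other : ∀ {f u v} → Joins e u v → f ∈ K → ¬ Touches u f → Touches v f
          other {f} jo f∈K ¬f with adj⇒touches jo (pairwise e f e∈K f∈K λ { refl → ¬f (_ , jo) })
          ... | inj₁ t = ⊥-elim (¬f t)
          ... | inj₂ t = t
          clash : ∀ {f g} → f ∈ K → ¬ Touches x f → g ∈ K → ¬ Touches y g → ⊥
          clash {f} {g} f∈K ¬f g∈K ¬g with other j f∈K ¬f | other (joins-sym j) g∈K ¬g
          ... | p , jf | q , jg with adj⇒share jf jg (pairwise f g f∈K g∈K λ { refl → ¬f (_ , jg) })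
          ...   | inj₁ (inj₁ r) = joins-irrefl j (sym r)
          ...   | inj₁ (inj₂ refl) = ¬g (_ , joins-sym jg)
          ...   | inj₂ (inj₁ refl) = ¬f (_ , joins-sym jf)
          ...   | inj₂ (inj₂ refl) = joins-side j (≢-≢⇒≡ (joins-side jg) (≢-sym (joins-side jf)))

      strongStable : StrongStable G (toSubset S)
      strongStable = stable , λ K K-max → decidable-stable
        (any? λ e → (e ∈? toSubset S) ×-dec (e ∈? K)) (impossible K-max)

    not-candidate : ⊥
    not-candidate = cover-all (allFin m) λ (S , M , covers) →
      proj₂ (proj₂ (proj₂ (proj₂ candidate)))
        (toSubset S , strongStable M (λ {x} → covers (∈-allFin x)) , contains-Z M (λ {x} → covers (∈-allFin x)))

theorem4p8 : (G : Graph) (Z : VSet G) → Suspect G Z → ¬ LineGraphOfBipartiteMultigraph G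
theorem4p8 G Z (candidate , _) (m , ends , side , bipartite , line) =
  LineGraph.Refutation.not-candidate G Z m ends side bipartite line candidate
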